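{- For every integer $n\ge 0$, $$\sum_{T\in \mathcal{PT}(n)} 2^{\operatorname{urc}(T)} = f(n+1),$$ where $f(m)$ denotes the number of connected permutations of $\{1,2,\dots,m\}$.
   Context: Connected permutations: a permutation $\pi=\pi_1\cdots\pi_m$ of $\{1,\dots,m\}$ is connected if there is no integer $1\le k<m$ such that $\pi_1\cdots\pi_k$ is a permutation of $\{1,\dots,k\}$. Ferrers diagrams: a Ferrers diagram is a left-justified arrangement of square cells, possibly with empty rows; its length is the number of rows plus the number of columns. The steps of the south-east border are labeled $1,\dots,n$ from north-east to south-west ($n$ the length); a row gets the label of its south step and a column the label of its west step. Equivalently, a diagram of length $n$ is a splitting of $\{1,\dots,n\}$ into row labels and column labels; rows are listed top to bottom in increasing order of label, columns left to right in decreasing order of label, and there is a cell in Row $r$ and Column $c$ exactly when $r<c$. Permutation tableaux: a permutation tableau is a Ferrers diagram with a filling of its cells by $0$'s and $1$'s such that (1) each column has at least one $1$; (2) there is no $0$ having both a $1$ above it in the same column and a $1$ to the left of it in the same row. $\mathcal{PT}(n)$ is the set of permutation tableaux of length $n$ ($\mathcal{PT}(0)$ consists of the single empty tableau). A column is unrestricted if it contains no $0$ that has a $1$ to the left of it in the same row; $\operatorname{urc}(T)$ is the number of unrestricted columns of $T$. -}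

module Defs where

open import Data.Bool using (Bool; true; false)
import Data.Bool.Properties as Bool
open import Data.Fin using (Fin; _<_)
import Data.Fin.Properties as Fin
open import Data.List as List
  using (List; []; _∷_; _++_; length; upTo; allFin; filter; cartesianProduct; cartesianProductWith)
open import Data.List.Membership.Propositional using (_∈_)
open import Data.List.Membership.Propositional.Properties
  using (∈-∃++; ∈-insert; ∈-cartesianProduct⁺; ∈-cartesianProductWith⁺; ∈-filter⁺; ∈-filter⁻)
import Data.List.Membership.DecPropositional as DecMembership
open import Data.List.Relation.Binary.Permutation.Propositional
  using (_↭_; ↭-refl; ↭-sym; ↭-trans; prep)
open import Data.List.Relation.Binary.Permutation.Propositional.Properties
  using (∈-resp-↭; ¬x∷xs↭[]; shift; drop-∷)
open import Data.List.Relation.Unary.All using ([]; _∷_)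
open import Data.List.Relation.Unary.AllPairs using ([]; _∷_)
open import Data.List.Relation.Unary.Any using (here; there)
open import Data.List.Relation.Unary.Unique.Propositional using (Unique)
import Data.List.Relation.Unary.Unique.Propositional.Properties as Unique
open import Data.Maybe using (Maybe; just; nothing; Is-just)
import Data.Maybe.Properties as Maybe
import Data.Maybe.Relation.Unary.Any as MaybeAny
open import Data.Nat as ℕ using (ℕ; zero; suc; _≤_)
import Data.Nat.Properties as ℕ
open import Data.Product using (_×_; _,_; ∃; proj₁; proj₂)
open import Data.Unit using (tt)
open import Data.Vec using (Vec; []; _∷_; lookup; toList)
open import Data.Vec.Properties using (∷-injective)
open import Function using (_∘_; _⇔_; mk⇔; Equivalence)
open import Relation.Binary using (DecidableEquality)
open import Relation.Binary.PropositionalEquality using (_≡_; refl)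
open import Relation.Nullary using (¬_; Dec; yes; no)
open import Relation.Nullary.Decidable using (map′; ¬?; _×-dec_; _→-dec_)
open import Relation.Unary using (Decidable)

------------------------------------------------------------------------
-- Listing all vectors with entries from a given list

vectors : ∀ {A : Set} → List A → (n : ℕ) → List (Vec A n)
vectors xs zero    = [] ∷ []
vectors xs (suc n) = cartesianProductWith _∷_ xs (vectors xs n)

vectors-complete : ∀ {A : Set} {xs : List A} {n} (v : Vec A n) →
                   (∀ {x} → x ∈ toList v → x ∈ xs) → v ∈ vectors xs n
vectors-complete []      v⊆xs = here refl
vectors-complete (x ∷ v) v⊆xs =
  ∈-cartesianProductWith⁺ _∷_ (v⊆xs (here refl)) (vectors-complete v (v⊆xs ∘ there))

vectors-unique : ∀ {A : Set} {xs : List A} → Unique xs → ∀ n → Unique (vectors xs n)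
vectors-unique xs! zero    = [] ∷ []
vectors-unique xs! (suc n) =
  Unique.cartesianProductWith⁺ _∷_ ∷-injective xs! (vectors-unique xs! n)

------------------------------------------------------------------------
-- Ferrers diagrams

-- The steps of the south-east border, listed from north-east to
-- south-west.  The index i : Fin n stands for the label i + 1.

data Step : Set where
  south west : Step

_≟ˢ_ : DecidableEquality Step
south ≟ˢ south = yes refl
south ≟ˢ west  = no λ ()
west  ≟ˢ south = no λ ()
west  ≟ˢ west  = yes refl

Diagram : ℕ → Set
Diagram n = Vec Step n

IsRow IsColumn : ∀ {n} → Diagram n → Fin n → Set
IsRow    d i = lookup d i ≡ south
IsColumn d i = lookup d i ≡ west

HasCell : ∀ {n} → Diagram n → Fin n → Fin n → Set
HasCell d r c = IsRow d r × IsColumn d c × r < c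

------------------------------------------------------------------------
-- Permutation tableaux

-- A diagram together with an array indexed by pairs of labels, where
-- `just true` is a 1, `just false` is a 0 and `nothing` means that there
-- is no cell; see Fills below.

Array : ℕ → Set
Array n = Diagram n × Vec (Vec (Maybe Bool) n) n

module _ {n : ℕ} (T : Array n) where

  entry : Fin n → Fin n → Maybe Bool
  entry r c = lookup (lookup (proj₂ T) r) c

  Fills : Set
  Fills = ∀ r c → Is-just (entry r c) ⇔ HasCell (proj₁ T) r c

  One Zero OneAbove OneToLeft : Fin n → Fin n → Set
  One  r c = entry r c ≡ just true
  Zero r c = entry r c ≡ just false

  OneAbove  r c = ∃ λ r′ → r′ < r × One r′ c
  -- Columns are arranged from left to right by decreasing label.
  OneToLeft r c = ∃ λ c′ → c < c′ × One r c′

  EveryColumnHasOne : Set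
  EveryColumnHasOne = ∀ c → IsColumn (proj₁ T) c → ∃ λ r → One r c

  NoForbiddenZero : Set
  NoForbiddenZero = ¬ (∃ λ r → ∃ λ c → Zero r c × OneAbove r c × OneToLeft r c)

  IsPermutationTableau : Set
  IsPermutationTableau = Fills × EveryColumnHasOne × NoForbiddenZero

  IsUnrestrictedColumn : Fin n → Set
  IsUnrestrictedColumn c =
    IsColumn (proj₁ T) c × ¬ (∃ λ r → Zero r c × OneToLeft r c)

  private
    _≟ᵉ_ : DecidableEquality (Maybe Bool)
    _≟ᵉ_ = Maybe.≡-dec Bool._≟_

    one? : ∀ r c → Dec (One r c)
    one? r c = entry r c ≟ᵉ just true

    zero? : ∀ r c → Dec (Zero r c)
    zero? r c = entry r c ≟ᵉ just false

    oneAbove? : ∀ r c → Dec (OneAbove r c)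
    oneAbove? r c = Fin.any? λ r′ → r′ Fin.<? r ×-dec one? r′ c

    oneToLeft? : ∀ r c → Dec (OneToLeft r c)
    oneToLeft? r c = Fin.any? λ c′ → c Fin.<? c′ ×-dec one? r c′

    isColumn? : ∀ c → Dec (IsColumn (proj₁ T) c)
    isColumn? c = lookup (proj₁ T) c ≟ˢ west

    hasCell? : ∀ r c → Dec (HasCell (proj₁ T) r c)
    hasCell? r c = lookup (proj₁ T) r ≟ˢ south ×-dec isColumn? c ×-dec r Fin.<? c

    isJust? : ∀ r c → Dec (Is-just (entry r c))
    isJust? r c = MaybeAny.dec (λ _ → yes tt) (entry r c)

    _⇔-dec_ : ∀ {A B : Set} → Dec A → Dec B → Dec (A ⇔ B)
    a? ⇔-dec b? = map′ (λ (to , from) → mk⇔ to from)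
                       (λ e → Equivalence.to e , Equivalence.from e)
                       ((a? →-dec b?) ×-dec (b? →-dec a?))

  isPermutationTableau? : Dec IsPermutationTableau
  isPermutationTableau? =
    Fin.all? (λ r → Fin.all? λ c → isJust? r c ⇔-dec hasCell? r c)
    ×-dec Fin.all? (λ c → isColumn? c →-dec Fin.any? λ r → one? r c)
    ×-dec ¬? (Fin.any? λ r → Fin.any? λ c →
                zero? r c ×-dec oneAbove? r c ×-dec oneToLeft? r c)

  isUnrestrictedColumn? : Decidable IsUnrestrictedColumn
  isUnrestrictedColumn? c =
    isColumn? c ×-dec ¬? (Fin.any? λ r → zero? r c ×-dec oneToLeft? r c)

  urc : ℕ
  urc = length (filter isUnrestrictedColumn? (allFin n))

steps : List Step
steps = south ∷ west ∷ []

entries : List (Maybe Bool)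
entries = nothing ∷ just false ∷ just true ∷ []

arrays : (n : ℕ) → List (Array n)
arrays n = cartesianProduct (vectors steps n) (vectors (vectors entries n) n)

𝒫𝒯 : (n : ℕ) → List (Array n)
𝒫𝒯 n = filter isPermutationTableau? (arrays n)

private
  ∈-steps : ∀ s → s ∈ steps
  ∈-steps south = here refl
  ∈-steps west  = there (here refl)

  ∈-entries : ∀ e → e ∈ entries
  ∈-entries nothing      = here refl
  ∈-entries (just false) = there (here refl)
  ∈-entries (just true)  = there (there (here refl))

  steps-unique : Unique steps
  steps-unique = ((λ ()) ∷ []) ∷ [] ∷ []

  entries-unique : Unique entries
  entries-unique = ((λ ()) ∷ (λ ()) ∷ []) ∷ ((λ ()) ∷ []) ∷ [] ∷ []

∈-𝒫𝒯 : ∀ {n} (T : Array n) → T ∈ 𝒫𝒯 n ⇔ IsPermutationTableau T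
∈-𝒫𝒯 {n} T@(d , a) =
  mk⇔ (proj₂ ∘ ∈-filter⁻ isPermutationTableau? {xs = arrays n})
      (∈-filter⁺ isPermutationTableau? T∈)
  where
  T∈ : T ∈ arrays n
  T∈ = ∈-cartesianProduct⁺
         (vectors-complete d λ _ → ∈-steps _)
         (vectors-complete a λ {v} _ → vectors-complete v λ _ → ∈-entries _)

𝒫𝒯-unique : ∀ n → Unique (𝒫𝒯 n)
𝒫𝒯-unique n = Unique.filter⁺ isPermutationTableau?
  (Unique.cartesianProduct⁺ (vectors-unique steps-unique n)
                            (vectors-unique (vectors-unique entries-unique n) n))

------------------------------------------------------------------------
-- Connected permutations, in one-line notation

[1⋯_] : ℕ → List ℕ
[1⋯ m ] = List.map suc (upTo m)

IsPermutation : ℕ → List ℕ → Set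
IsPermutation m w = w ↭ [1⋯ m ]

IsConnectedPermutation : (m : ℕ) → Vec ℕ m → Set
IsConnectedPermutation m π =
  IsPermutation m (toList π) ×
  ¬ (∃ λ k → k ℕ.< m × 1 ≤ k × IsPermutation k (List.take k (toList π)))

_↭?_ : (xs ys : List ℕ) → Dec (xs ↭ ys)
[]       ↭? []       = yes ↭-refl
[]       ↭? (y ∷ ys) = no (¬x∷xs↭[] ∘ ↭-sym)
(x ∷ xs) ↭? ys with DecMembership._∈?_ ℕ._≟_ x ys
... | no x∉ys = no λ p → x∉ys (∈-resp-↭ p (here refl))
... | yes x∈ys with as , bs , refl ← ∈-∃++ x∈ys =
  map′ (λ p → ↭-trans (prep x p) (↭-sym (shift x as bs)))
       (λ p → drop-∷ (↭-trans p (shift x as bs)))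
       (xs ↭? (as ++ bs))

isConnectedPermutation? : ∀ m → Decidable (IsConnectedPermutation m)
isConnectedPermutation? m π =
  (toList π ↭? [1⋯ m ])
  ×-dec ¬? (ℕ.anyUpTo? (λ k → 1 ℕ.≤? k ×-dec (List.take k (toList π) ↭? [1⋯ k ])) m)

connectedPermutations : (m : ℕ) → List (Vec ℕ m)
connectedPermutations m = filter (isConnectedPermutation? m) (vectors [1⋯ m ] m)

∈-connectedPermutations : ∀ {m} (π : Vec ℕ m) →
  π ∈ connectedPermutations m ⇔ IsConnectedPermutation m π
∈-connectedPermutations {m} π =
  mk⇔ (proj₂ ∘ ∈-filter⁻ (isConnectedPermutation? m) {xs = vectors [1⋯ m ] m})
      (λ p → ∈-filter⁺ (isConnectedPermutation? m)
               (vectors-complete π (∈-resp-↭ (proj₁ p))) p)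

connectedPermutations-unique : ∀ m → Unique (connectedPermutations m)
connectedPermutations-unique m = Unique.filter⁺ (isConnectedPermutation? m)
  (vectors-unique (Unique.map⁺ ℕ.suc-injective (Unique.upTo⁺ m)) m)

f : ℕ → ℕ
f m = length (connectedPermutations m)

{-# OPTIONS --safe #-}

-- A tableau is built by adding labels in decreasing order, that is, new top
-- rows and new rightmost columns.  In an intermediate stage columns may still
-- be empty, and its extensions depend only on the word of unrestricted columns,
-- each marked as filled or empty.  If a filled column weighs y + 1 and an empty
-- one y, the total weight of the stage with n labels is (y + 1) ⋯ (y + n), which
-- is (n + 1)! for y = 1.  Cutting a word at its leftmost empty column separates
-- an arbitrary word from one without empty columns, so that
-- P n = ∑ 2 ^ urc T satisfies ∑_{i + j = n} i! P j = (n + 1)!.  Cutting a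
-- permutation after its first connected component gives the same recurrence
-- for P j = f (j + 1), and the recurrence has a unique solution.

module Submission where

open import Defs
open import Data.Bool using (Bool; true; false; if_then_else_; _∨_)
open import Data.Bool.Properties using (∨-zeroʳ)
open import Data.Empty using (⊥-elim)
open import Data.Fin as Fin using (Fin; zero; suc)
import Data.Fin.Properties as Fin
open import Data.List using (List; []; _∷_; _++_; map; concatMap; cartesianProductWith; filter; length; allFin; tabulate; applyUpTo; take; drop)
open import Data.List.Properties using (map-++; map-∘; map-cong; map-upTo; take-take; take-all; take++drop≡id; length-applyUpTo)
open import Data.List.Membership.Propositional using (_∈_; find)
open import Data.List.Membership.Propositional.Properties using (∈-∃++; ∈-applyUpTo⁻; ∈-filter⁺; ∈-filter⁻; ∈-++⁺ʳ)
open import Data.List.Membership.Propositional.Properties.WithK using (unique∧set⇒bag)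
import Data.List.Membership.DecPropositional as DecMembership
open import Data.List.Relation.Binary.BagAndSetEquality using (∼bag⇒↭)
open import Data.List.Relation.Binary.Permutation.Propositional using (_↭_; ↭-sym; ↭-trans; ↭-reflexive; ↭⇒↭ₛ; prep)
open import Data.List.Relation.Binary.Permutation.Propositional.Properties using (∈-resp-↭; Any-resp-↭; shift; drop-∷; ↭-length; ++⁺; ++⁺ʳ)
import Data.List.Relation.Binary.Permutation.Setoid.Properties as SetoidPermutation
open import Data.List.Relation.Unary.AllPairs using ([]; _∷_)
open import Data.List.Relation.Unary.Any using (Any; here; there)
open import Data.List.Relation.Unary.Unique.Propositional using (Unique)
import Data.List.Relation.Unary.Unique.Propositional.Properties as Unique
open import Data.Maybe as Maybe using (Maybe; just; nothing; maybe; fromMaybe; _>>=_; Is-just)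
import Data.Maybe.Relation.Unary.Any as MaybeAny
open import Data.Nat using (ℕ; zero; suc; _+_; _*_; _^_; _!; _≤_; _<_; z≤n; s≤s; z<s; s<s; s<s⁻¹)
open import Data.Nat.ListAction using (sum)
open import Data.Nat.ListAction.Properties using (sum-++)
open import Data.Nat.Properties
open import Data.Nat.Tactic.RingSolver using (solve-∀)
open import Data.Product using (_×_; _,_; ∃; proj₁; proj₂; map₁; uncurry)
open import Data.Sum as Sum using (_⊎_; inj₁; inj₂; [_,_]′)
open import Data.Unit using (tt)
open import Data.Vec as Vec using (Vec; []; _∷_; tail; lookup; toList)
open import Data.Vec.Properties using (lookup-map; length-toList)
open import Function using (_∘_; id; _⇔_; mk⇔; Equivalence)
open import Function.Construct.Symmetry using (⇔-sym)
open import Relation.Binary.PropositionalEquality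
open import Relation.Nullary using (Dec; yes; no; ¬_; does; contradiction)
open import Relation.Nullary.Decidable using (¬?; _×-dec_; dec-true; dec-false; does-⇔)
open import Relation.Unary using (Decidable)
open Equivalence using (to; from)
open ≡-Reasoning

-- The weight wanted at the end is 2 for a filled and 0 for an empty column, but its sums over one
-- more label do not close up, since an empty column may still be filled later. Suppose instead that
-- a filled column weighs p and an empty one q, and let S be the sum of the weight w over the
-- effects of a new row with a 1. If S + c w is to acquire a constant factor with each letter of the
-- word, comparing coefficients gives c = p and p = q + 1, and the factors are p + 1 and p. Moreover
-- c = q + 1 is just what a new column and a row of 0s contribute. This is the origin of the weights
-- y + 1 and y. Since 2 ^ urc requires p = 2, one has to take y = 1, so that empty columns get
-- weight 1 instead of 0; cutting the words repairs this. Tableaux enter through sums over all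
-- arrays, with weight 0 for the rejected ones, so no bijection between tableaux and words has to be
-- constructed.

private variable
  A B C P Q : Set

-- Finite sums over lists, and indicators of decidable propositions.

∑ : List A → (A → ℕ) → ℕ
∑ xs F = sum (map F xs)

syntax ∑ xs (λ x → e) = ∑[ x ∈ xs ] e
infixr 8 ∑

∑-cong : ∀ {F G : A → ℕ} → (∀ x → F x ≡ G x) → ∀ xs → ∑ xs F ≡ ∑ xs G
∑-cong F≗G xs = cong sum (map-cong F≗G xs)

∑-zero : ∀ (xs : List A) → ∑[ x ∈ xs ] 0 ≡ 0
∑-zero []       = refl
∑-zero (x ∷ xs) = ∑-zero xs

∑-++ : ∀ (F : A → ℕ) xs ys → ∑ (xs ++ ys) F ≡ ∑ xs F + ∑ ys F
∑-++ F xs ys = trans (cong sum (map-++ F xs ys)) (sum-++ (map F xs) (map F ys))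

∑-map : ∀ (F : B → ℕ) (g : A → B) xs → ∑ (map g xs) F ≡ ∑ xs (F ∘ g)
∑-map F g xs = cong sum (sym (map-∘ xs))

∑-concatMap : ∀ (F : B → ℕ) (g : A → List B) xs →
              ∑ (concatMap g xs) F ≡ ∑[ x ∈ xs ] ∑ (g x) F
∑-concatMap F g []       = refl
∑-concatMap F g (x ∷ xs) =
  trans (∑-++ F (g x) (concatMap g xs)) (cong (∑ (g x) F +_) (∑-concatMap F g xs))

∑-+ : ∀ (F G : A → ℕ) xs → ∑[ x ∈ xs ] (F x + G x) ≡ ∑ xs F + ∑ xs G
∑-+ F G []       = refl
∑-+ F G (x ∷ xs) = trans (cong (F x + G x +_) (∑-+ F G xs))
                         (interchange (F x) (G x) (∑ xs F) (∑ xs G))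
  where
  interchange : ∀ a b c d → a + b + (c + d) ≡ a + c + (b + d)
  interchange = solve-∀

∑-*ˡ : ∀ c (F : A → ℕ) xs → ∑[ x ∈ xs ] (c * F x) ≡ c * ∑ xs F
∑-*ˡ c F []       = sym (*-zeroʳ c)
∑-*ˡ c F (x ∷ xs) = trans (cong (c * F x +_) (∑-*ˡ c F xs))
                          (sym (*-distribˡ-+ c (F x) (∑ xs F)))

∑-swap : ∀ (F : A → B → ℕ) xs ys →
         ∑[ x ∈ xs ] ∑[ y ∈ ys ] F x y ≡ ∑[ y ∈ ys ] ∑[ x ∈ xs ] F x y
∑-swap F []       ys = sym (∑-zero ys)
∑-swap F (x ∷ xs) ys = trans (cong (∑ ys (F x) +_) (∑-swap F xs ys))
                             (sym (∑-+ (F x) (λ y → ∑[ x ∈ xs ] F x y) ys))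

∑-cartesianProductWith : ∀ (F : C → ℕ) (g : A → B → C) xs ys →
  ∑ (cartesianProductWith g xs ys) F ≡ ∑[ x ∈ xs ] ∑[ y ∈ ys ] F (g x y)
∑-cartesianProductWith F g []       ys = refl
∑-cartesianProductWith F g (x ∷ xs) ys =
  trans (∑-++ F (map (g x) ys) (cartesianProductWith g xs ys))
        (cong₂ _+_ (∑-map F (g x) ys) (∑-cartesianProductWith F g xs ys))

∑-cong-∈ : ∀ {F G : A → ℕ} xs → (∀ {x} → x ∈ xs → F x ≡ G x) → ∑ xs F ≡ ∑ xs G
∑-cong-∈ []       F≡G = refl
∑-cong-∈ (x ∷ xs) F≡G = cong₂ _+_ (F≡G (here refl)) (∑-cong-∈ xs (F≡G ∘ there))

∑-*ʳ : ∀ c (F : A → ℕ) xs → ∑[ x ∈ xs ] (F x * c) ≡ ∑ xs F * c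
∑-*ʳ c F xs = trans (∑-cong (λ x → *-comm (F x) c) xs) (trans (∑-*ˡ c F xs) (*-comm c (∑ xs F)))

length≡∑ : ∀ (xs : List A) → length xs ≡ ∑[ x ∈ xs ] 1
length≡∑ []       = refl
length≡∑ (x ∷ xs) = cong suc (length≡∑ xs)

∑-filter : ∀ {P : A → Set} (P? : Decidable P) F xs →
  ∑ (filter P? xs) F ≡ ∑[ x ∈ xs ] (if does (P? x) then F x else 0)
∑-filter P? F []       = refl
∑-filter P? F (x ∷ xs) with does (P? x)
... | true  = cong (F x +_) (∑-filter P? F xs)
... | false = ∑-filter P? F xs

∑-vectors-suc : ∀ (xs : List A) n F →
  ∑ (vectors xs (suc n)) F ≡ ∑[ x ∈ xs ] ∑[ v ∈ vectors xs n ] F (x ∷ v)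
∑-vectors-suc xs n F = ∑-cartesianProductWith F _∷_ xs (vectors xs n)

χ : Dec P → ℕ
χ P? = if does P? then 1 else 0

χ-yes : (P? : Dec P) → P → χ P? ≡ 1
χ-yes P? p = cong (if_then 1 else 0) (dec-true P? p)

χ-no : (P? : Dec P) → ¬ P → χ P? ≡ 0
χ-no P? ¬p = cong (if_then 1 else 0) (dec-false P? ¬p)

χ-⇔ : P ⇔ Q → (P? : Dec P) (Q? : Dec Q) → χ P? ≡ χ Q?
χ-⇔ P⇔Q P? Q? = cong (if_then 1 else 0) (does-⇔ P⇔Q P? Q?)

length-filter≡∑χ : ∀ {P : A → Set} (P? : Decidable P) xs → length (filter P? xs) ≡ ∑[ x ∈ xs ] χ (P? x)
length-filter≡∑χ P? xs = trans (length≡∑ (filter P? xs)) (∑-filter P? (λ _ → 1) xs)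

-- Convolution

diag : (ℕ → ℕ → ℕ) → ℕ → ℕ
diag h zero    = h 0 0
diag h (suc n) = h 0 (suc n) + diag (h ∘ suc) n

diag-cong : ∀ {h h′} n → (∀ i j → i + j ≡ n → h i j ≡ h′ i j) → diag h n ≡ diag h′ n
diag-cong zero    h≡h′ = h≡h′ 0 0 refl
diag-cong (suc n) h≡h′ =
  cong₂ _+_ (h≡h′ 0 (suc n) refl) (diag-cong n λ i j i+j≡n → h≡h′ (suc i) j (cong suc i+j≡n))

infixl 7 _⋆_

_⋆_ : (ℕ → ℕ) → (ℕ → ℕ) → ℕ → ℕ
(a ⋆ b) = diag λ i j → a i * b j

∑-diag : ∀ (F : A → ℕ → ℕ → ℕ) n xs → ∑[ x ∈ xs ] diag (F x) n ≡ diag (λ i j → ∑[ x ∈ xs ] F x i j) n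
∑-diag F zero    xs = refl
∑-diag F (suc n) xs = trans (∑-+ (λ x → F x 0 (suc n)) (λ x → diag (F x ∘ suc) n) xs)
                            (cong (∑[ x ∈ xs ] F x 0 (suc n) +_) (∑-diag (λ x → F x ∘ suc) n xs))

diag-zero : ∀ n → diag (λ _ _ → 0) n ≡ 0
diag-zero zero    = refl
diag-zero (suc n) = diag-zero n

-- Strong induction: as `a 0` is 1, each equation determines the value at its index from the values
-- at smaller indices.
⋆-cancelˡ : ∀ {a b c} → a 0 ≡ 1 → (∀ n → (a ⋆ b) n ≡ (a ⋆ c) n) → ∀ n → b n ≡ c n
⋆-cancelˡ {a} {b} {c} a₀≡1 eq n = agree n n ≤-refl
  where
  drop-a₀ : ∀ x y → a 0 * x ≡ a 0 * y → x ≡ y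
  drop-a₀ x y p rewrite a₀≡1 = trans (sym (*-identityˡ x)) (trans p (*-identityˡ y))

  agree : ∀ n j → j ≤ n → b j ≡ c j
  agree zero    .0 z≤n = drop-a₀ (b 0) (c 0) (eq 0)
  agree (suc n) j  j≤1+n with m≤n⇒m<n∨m≡n j≤1+n
  ... | inj₁ (s≤s j≤n) = agree n j j≤n
  ... | inj₂ refl      = drop-a₀ (b (suc n)) (c (suc n)) (+-cancelʳ-≡ _ _ _ (trans (eq (suc n))
        (cong (a 0 * c (suc n) +_)
          (sym (diag-cong n λ i j i+j≡n → cong (a (suc i) *_) (agree n j (m+n≤o⇒n≤o i (≤-reflexive i+j≡n))))))))

-- Words of unrestricted columns

-- The state of a partial tableau: its unrestricted columns from right to
-- left, each marked according to whether it already contains a 1.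
data Mark : Set where
  filled empty : Mark

Word : Set
Word = List Mark

-- The effects of a new top row containing a 1.  Everything to the right of
-- its leftmost 1 ends up filled or restricted; a restricted column leaves
-- the word, and must be filled since no later row can put a 1 into it.
successors⁺ : Word → List Word
successors⁺ []           = []
successors⁺ (filled ∷ u) = (filled ∷ u) ∷ concatMap (λ u′ → (filled ∷ u′) ∷ u′ ∷ []) (successors⁺ u)
successors⁺ (empty ∷ u)  = (filled ∷ u) ∷ map (filled ∷_) (successors⁺ u)

-- The three kinds of step are a new column, which enters at the right end of the tableau and hence
-- at the head of the word, a new row of 0s, and a new row with a 1.
successors : Word → List Word
successors u = (empty ∷ u) ∷ u ∷ successors⁺ u

-- Repetitions matter: a word occurs once for each partial tableau with `n` labels in that state, as
-- `∑-run` confirms.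
words : ℕ → List Word
words zero    = [] ∷ []
words (suc n) = concatMap successors (words n)

∑-successors⁺-filled : ∀ (F : Word → ℕ) u → ∑ (successors⁺ (filled ∷ u)) F ≡
  F (filled ∷ u) + (∑ (successors⁺ u) (F ∘ (filled ∷_)) + ∑ (successors⁺ u) F)
∑-successors⁺-filled F u = cong (F (filled ∷ u) +_) (begin
  ∑ (concatMap _ (successors⁺ u)) F                    ≡⟨ ∑-concatMap F _ (successors⁺ u) ⟩
  ∑[ u′ ∈ successors⁺ u ] (F (filled ∷ u′) + (F u′ + 0))
    ≡⟨ ∑-cong (λ u′ → cong (F (filled ∷ u′) +_) (+-identityʳ (F u′))) (successors⁺ u) ⟩
  ∑[ u′ ∈ successors⁺ u ] (F (filled ∷ u′) + F u′)     ≡⟨ ∑-+ (F ∘ (filled ∷_)) F (successors⁺ u) ⟩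
  ∑ (successors⁺ u) (F ∘ (filled ∷_)) + ∑ (successors⁺ u) F ∎)

∑-successors⁺-empty : ∀ (F : Word → ℕ) u → ∑ (successors⁺ (empty ∷ u)) F ≡
  F (filled ∷ u) + ∑ (successors⁺ u) (F ∘ (filled ∷_))
∑-successors⁺-empty F u = cong (F (filled ∷ u) +_) (∑-map F (filled ∷_) (successors⁺ u))

-- These weights turn the sum over successors into the shift y ↦ y + 1.
φ : ℕ → Word → ℕ
φ y []           = 1
φ y (filled ∷ u) = suc y * φ y u
φ y (empty ∷ u)  = y * φ y u

-- The sum over `successors⁺` is the difference of `φ (suc y) u` and `φ y u`, times `suc y`. The
-- subtracted term is moved to the other side, where it is the joint contribution of a new column
-- and a row of 0s.
∑-successors⁺-φ : ∀ y u → ∑ (successors⁺ u) (φ y) + suc y * φ y u ≡ suc y * φ (suc y) u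
∑-successors⁺-φ y []           = refl
∑-successors⁺-φ y (filled ∷ u) = begin
  ∑ (successors⁺ (filled ∷ u)) (φ y) + suc y * (suc y * φ y u)
    ≡⟨ cong (_+ suc y * (suc y * φ y u)) (∑-successors⁺-filled (φ y) u) ⟩
  suc y * φ y u + (∑[ u′ ∈ successors⁺ u ] (suc y * φ y u′) + s) + suc y * (suc y * φ y u)
    ≡⟨ cong (λ t → suc y * φ y u + (t + s) + suc y * (suc y * φ y u)) (∑-*ˡ (suc y) (φ y) (successors⁺ u)) ⟩
  suc y * φ y u + (suc y * s + s) + suc y * (suc y * φ y u)
    ≡⟨ regroup y (φ y u) s ⟩
  suc (suc y) * (s + suc y * φ y u)
    ≡⟨ cong (suc (suc y) *_) (∑-successors⁺-φ y u) ⟩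
  suc (suc y) * (suc y * φ (suc y) u)
    ≡⟨ *-comm-middle (suc (suc y)) (suc y) (φ (suc y) u) ⟩
  suc y * (suc (suc y) * φ (suc y) u) ∎
  where
  s = ∑ (successors⁺ u) (φ y)

  regroup : ∀ y p s → suc y * p + (suc y * s + s) + suc y * (suc y * p) ≡ suc (suc y) * (s + suc y * p)
  regroup = solve-∀

  *-comm-middle : ∀ a b c → a * (b * c) ≡ b * (a * c)
  *-comm-middle = solve-∀
∑-successors⁺-φ y (empty ∷ u) = begin
  ∑ (successors⁺ (empty ∷ u)) (φ y) + suc y * (y * φ y u)
    ≡⟨ cong (_+ suc y * (y * φ y u)) (∑-successors⁺-empty (φ y) u) ⟩
  suc y * φ y u + ∑[ u′ ∈ successors⁺ u ] (suc y * φ y u′) + suc y * (y * φ y u)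
    ≡⟨ cong (λ t → suc y * φ y u + t + suc y * (y * φ y u)) (∑-*ˡ (suc y) (φ y) (successors⁺ u)) ⟩
  suc y * φ y u + suc y * s + suc y * (y * φ y u)
    ≡⟨ regroup y (φ y u) s ⟩
  suc y * (s + suc y * φ y u)
    ≡⟨ cong (suc y *_) (∑-successors⁺-φ y u) ⟩
  suc y * (suc y * φ (suc y) u) ∎
  where
  s = ∑ (successors⁺ u) (φ y)

  regroup : ∀ y p s → suc y * p + suc y * s + suc y * (y * p) ≡ suc y * (s + suc y * p)
  regroup = solve-∀

∑-successors-φ : ∀ y u → ∑ (successors u) (φ y) ≡ suc y * φ (suc y) u
∑-successors-φ y u =
  trans (regroup y (φ y u) (∑ (successors⁺ u) (φ y))) (∑-successors⁺-φ y u)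
  where
  regroup : ∀ y p s → y * p + (p + s) ≡ s + suc y * p
  regroup = solve-∀

-- The product of `k + 1` up to `k + n` is a quotient of factorials, here cleared of its
-- denominator. Each step of the induction raises `k`, so `k` stays general.
∑-words-φ : ∀ n k → ∑ (words n) (φ k) * k ! ≡ (k + n) !
∑-words-φ zero    k = trans (+-identityʳ (k !)) (cong _! (sym (+-identityʳ k)))
∑-words-φ (suc n) k = begin
  ∑ (words (suc n)) (φ k) * k !                      ≡⟨ cong (_* k !) (∑-concatMap (φ k) successors (words n)) ⟩
  ∑[ u ∈ words n ] ∑ (successors u) (φ k) * k !      ≡⟨ cong (_* k !) (∑-cong (∑-successors-φ k) (words n)) ⟩
  ∑[ u ∈ words n ] (suc k * φ (suc k) u) * k !       ≡⟨ cong (_* k !) (∑-*ˡ (suc k) (φ (suc k)) (words n)) ⟩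
  suc k * ∑ (words n) (φ (suc k)) * k !              ≡⟨ regroup (suc k) (∑ (words n) (φ (suc k))) (k !) ⟩
  ∑ (words n) (φ (suc k)) * (suc k) !                ≡⟨ ∑-words-φ n (suc k) ⟩
  (suc k + n) !                                      ≡⟨ cong _! (sym (+-suc k n)) ⟩
  (k + suc n) !                                      ∎
  where
  regroup : ∀ a b c → a * b * c ≡ b * (a * c)
  regroup = solve-∀

-- All ways of cutting a word at an empty column.  While that column stays
-- empty, everything to its left is frozen, so ⊙ makes the two sides evolve
-- independently.
splits : Word → List (Word × Word)
splits []           = []
splits (filled ∷ u) = map (map₁ (filled ∷_)) (splits u)
splits (empty ∷ u)  = ([] , u) ∷ map (map₁ (empty ∷_)) (splits u)

infixl 7 _⊙_

_⊙_ : (Word → ℕ) → (Word → ℕ) → Word → ℕ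
(F ⊙ G) u = ∑[ (v , w) ∈ splits u ] (F v * G w)

⊙-cong : ∀ {F F′} → (∀ u → F u ≡ F′ u) → ∀ G u → (F ⊙ G) u ≡ (F′ ⊙ G) u
⊙-cong F≗F′ G u = ∑-cong (λ (v , w) → cong (_* G w) (F≗F′ v)) (splits u)

⊙-+ : ∀ F F′ G u → ((λ v → F v + F′ v) ⊙ G) u ≡ (F ⊙ G) u + (F′ ⊙ G) u
⊙-+ F F′ G u =
  trans (∑-cong (λ (v , w) → *-distribʳ-+ (G w) (F v) (F′ v)) (splits u)) (∑-+ _ _ (splits u))

⊙-filled : ∀ F G u → (F ⊙ G) (filled ∷ u) ≡ ((F ∘ (filled ∷_)) ⊙ G) u
⊙-filled F G u = ∑-map _ (map₁ (filled ∷_)) (splits u)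

⊙-empty : ∀ F G u → (F ⊙ G) (empty ∷ u) ≡ F [] * G u + ((F ∘ (empty ∷_)) ⊙ G) u
⊙-empty F G u = cong (F [] * G u +_) (∑-map _ (map₁ (empty ∷_)) (splits u))

-- If a column is empty after a new row with a 1, it was empty before, and the row has no 1 in it or
-- to its left. Hence the row acts only on the part to the right of the cut. The induction passes to
-- `F ∘ (filled ∷_)`, so `F` stays general.
∑-successors⁺-⊙ : ∀ F G u → ∑ (successors⁺ u) (F ⊙ G) ≡ ((λ v → ∑ (successors⁺ v) F) ⊙ G) u
∑-successors⁺-⊙ F G []           = refl
∑-successors⁺-⊙ F G (filled ∷ u) = begin
  ∑ (successors⁺ (filled ∷ u)) (F ⊙ G)
    ≡⟨ ∑-successors⁺-filled (F ⊙ G) u ⟩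
  (F ⊙ G) (filled ∷ u) + (∑[ v ∈ successors⁺ u ] (F ⊙ G) (filled ∷ v) + ∑ (successors⁺ u) (F ⊙ G))
    ≡⟨ cong₂ _+_ (⊙-filled F G u)
         (cong₂ _+_ (trans (∑-cong (⊙-filled F G) (successors⁺ u)) (∑-successors⁺-⊙ Fᶠ G u))
                    (∑-successors⁺-⊙ F G u)) ⟩
  (Fᶠ ⊙ G) u + ((F⁺ᶠ ⊙ G) u + (F⁺ ⊙ G) u)
    ≡⟨ cong ((Fᶠ ⊙ G) u +_) (⊙-+ F⁺ᶠ F⁺ G u) ⟨
  (Fᶠ ⊙ G) u + ((λ v → F⁺ᶠ v + F⁺ v) ⊙ G) u
    ≡⟨ ⊙-+ Fᶠ (λ v → F⁺ᶠ v + F⁺ v) G u ⟨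
  ((λ v → Fᶠ v + (F⁺ᶠ v + F⁺ v)) ⊙ G) u
    ≡⟨ ⊙-cong (∑-successors⁺-filled F) G u ⟨
  ((F⁺ ∘ (filled ∷_)) ⊙ G) u
    ≡⟨ ⊙-filled F⁺ G u ⟨
  (F⁺ ⊙ G) (filled ∷ u) ∎
  where
  Fᶠ F⁺ F⁺ᶠ : Word → ℕ
  Fᶠ    = F ∘ (filled ∷_)
  F⁺ v  = ∑ (successors⁺ v) F
  F⁺ᶠ v = ∑ (successors⁺ v) Fᶠ
∑-successors⁺-⊙ F G (empty ∷ u) = begin
  ∑ (successors⁺ (empty ∷ u)) (F ⊙ G)
    ≡⟨ ∑-successors⁺-empty (F ⊙ G) u ⟩
  (F ⊙ G) (filled ∷ u) + ∑[ v ∈ successors⁺ u ] (F ⊙ G) (filled ∷ v)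
    ≡⟨ cong₂ _+_ (⊙-filled F G u)
         (trans (∑-cong (⊙-filled F G) (successors⁺ u)) (∑-successors⁺-⊙ Fᶠ G u)) ⟩
  (Fᶠ ⊙ G) u + (F⁺ᶠ ⊙ G) u
    ≡⟨ ⊙-+ Fᶠ F⁺ᶠ G u ⟨
  ((λ v → Fᶠ v + F⁺ᶠ v) ⊙ G) u
    ≡⟨ ⊙-cong (∑-successors⁺-empty F) G u ⟨
  ((F⁺ ∘ (empty ∷_)) ⊙ G) u
    -- The cut at the leading column contributes `F⁺ [] * G u`, which computes to 0 since
    -- `successors⁺ []` is empty.
    ≡⟨ ⊙-empty F⁺ G u ⟨
  (F⁺ ⊙ G) (empty ∷ u) ∎
  where
  Fᶠ F⁺ F⁺ᶠ : Word → ℕ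
  Fᶠ    = F ∘ (filled ∷_)
  F⁺ v  = ∑ (successors⁺ v) F
  F⁺ᶠ v = ∑ (successors⁺ v) Fᶠ

-- The extra term is the cut at a column just added: nothing lies to its right and all of `u` to its
-- left. At the older cuts the new column or row belongs to the right part.
∑-successors-⊙ : ∀ F G u →
  ∑ (successors u) (F ⊙ G) ≡ F [] * G u + ((λ v → ∑ (successors v) F) ⊙ G) u
∑-successors-⊙ F G u = begin
  (F ⊙ G) (empty ∷ u) + ((F ⊙ G) u + ∑ (successors⁺ u) (F ⊙ G))
    ≡⟨ cong₂ _+_ (⊙-empty F G u) (cong ((F ⊙ G) u +_) (∑-successors⁺-⊙ F G u)) ⟩
  F [] * G u + (Fᵉ ⊙ G) u + ((F ⊙ G) u + (F⁺ ⊙ G) u)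
    ≡⟨ cong (F [] * G u + (Fᵉ ⊙ G) u +_) (⊙-+ F F⁺ G u) ⟨
  F [] * G u + (Fᵉ ⊙ G) u + ((λ v → F v + F⁺ v) ⊙ G) u
    ≡⟨ +-assoc (F [] * G u) _ _ ⟩
  F [] * G u + ((Fᵉ ⊙ G) u + ((λ v → F v + F⁺ v) ⊙ G) u)
    ≡⟨ cong (F [] * G u +_) (⊙-+ Fᵉ (λ v → F v + F⁺ v) G u) ⟨
  F [] * G u + ((λ v → ∑ (successors v) F) ⊙ G) u ∎
  where
  Fᵉ F⁺ : Word → ℕ
  Fᵉ   = F ∘ (empty ∷_)
  F⁺ v = ∑ (successors⁺ v) F

-- One of the `suc n` labels is the cut column; the `j` labels added before it build the left part,
-- the `i` labels added after it the right part. The induction undoes the last step: if it creates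
-- the cut column it gives the term with `i` zero, otherwise it is absorbed into `F`.
∑-words-⊙ : ∀ n F G → ∑ (words (suc n)) (F ⊙ G) ≡
  ((λ i → ∑ (words i) F) ⋆ (λ j → ∑ (words j) G)) n
∑-words-⊙ n F G = begin
  ∑ (words (suc n)) (F ⊙ G)
    ≡⟨ ∑-concatMap (F ⊙ G) successors (words n) ⟩
  ∑[ u ∈ words n ] ∑ (successors u) (F ⊙ G)
    ≡⟨ ∑-cong (∑-successors-⊙ F G) (words n) ⟩
  ∑[ u ∈ words n ] (F [] * G u + (F′ ⊙ G) u)
    ≡⟨ ∑-+ _ _ (words n) ⟩
  ∑[ u ∈ words n ] (F [] * G u) + ∑ (words n) (F′ ⊙ G)
    ≡⟨ cong (_+ ∑ (words n) (F′ ⊙ G)) (∑-*ˡ (F []) G (words n)) ⟩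
  F [] * ∑ (words n) G + ∑ (words n) (F′ ⊙ G)
    ≡⟨ cong (λ c → c * ∑ (words n) G + ∑ (words n) (F′ ⊙ G)) (+-identityʳ (F [])) ⟨
  ∑ (words 0) F * ∑ (words n) G + ∑ (words n) (F′ ⊙ G)
    ≡⟨ rest n ⟩
  ((λ i → ∑ (words i) F) ⋆ (λ j → ∑ (words j) G)) n ∎
  where
  F′ : Word → ℕ
  F′ v = ∑ (successors v) F

  rest : ∀ n → ∑ (words 0) F * ∑ (words n) G + ∑ (words n) (F′ ⊙ G) ≡
               ((λ i → ∑ (words i) F) ⋆ (λ j → ∑ (words j) G)) n
  rest zero    = +-identityʳ _
  rest (suc n) = cong (∑ (words 0) F * ∑ (words (suc n)) G +_) (begin
    ∑ (words (suc n)) (F′ ⊙ G)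
      ≡⟨ ∑-words-⊙ n F′ G ⟩
    ((λ i → ∑ (words i) F′) ⋆ (λ j → ∑ (words j) G)) n
      ≡⟨ diag-cong n (λ i j _ → cong (_* ∑ (words j) G) (sym (∑-concatMap F successors (words i)))) ⟩
    ((λ i → ∑ (words (suc i)) F) ⋆ (λ j → ∑ (words j) G)) n ∎)

-- The weight of finished tableaux and its recurrence.

ψ : Word → ℕ
ψ []           = 1
ψ (filled ∷ u) = 2 * ψ u
ψ (empty ∷ u)  = 0

-- Of all cuts of `u` only the one at the leftmost empty column survives, because `ψ` vanishes on a
-- left part that still has an empty column. The cut column itself weighs 1 for `y` equal to 1, so
-- it can be left out of the product.
φ-split : ∀ u → φ 1 u ≡ ψ u + (φ 1 ⊙ ψ) u
φ-split []           = refl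
φ-split (filled ∷ u) = begin
  2 * φ 1 u                                     ≡⟨ cong (2 *_) (φ-split u) ⟩
  2 * (ψ u + (φ 1 ⊙ ψ) u)                       ≡⟨ *-distribˡ-+ 2 (ψ u) ((φ 1 ⊙ ψ) u) ⟩
  2 * ψ u + 2 * (φ 1 ⊙ ψ) u                     ≡⟨ cong (2 * ψ u +_) (∑-*ˡ 2 _ (splits u)) ⟨
  2 * ψ u + ∑[ (v , w) ∈ splits u ] (2 * (φ 1 v * ψ w))
    ≡⟨ cong (2 * ψ u +_) (∑-cong (λ (v , w) → *-assoc 2 (φ 1 v) (ψ w)) (splits u)) ⟨
  2 * ψ u + ((φ 1 ∘ (filled ∷_)) ⊙ ψ) u         ≡⟨ cong (2 * ψ u +_) (⊙-filled (φ 1) ψ u) ⟨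
  2 * ψ u + (φ 1 ⊙ ψ) (filled ∷ u)              ∎
φ-split (empty ∷ u)  = begin
  1 * φ 1 u                                     ≡⟨ *-identityˡ (φ 1 u) ⟩
  φ 1 u                                         ≡⟨ φ-split u ⟩
  ψ u + (φ 1 ⊙ ψ) u                             ≡⟨ cong₂ _+_ (*-identityˡ (ψ u)) (⊙-cong (λ v → *-identityˡ (φ 1 v)) ψ u) ⟨
  1 * ψ u + ((φ 1 ∘ (empty ∷_)) ⊙ ψ) u          ≡⟨ ⊙-empty (φ 1) ψ u ⟨
  (φ 1 ⊙ ψ) (empty ∷ u)                         ∎

∑-words-φ₁ : ∀ n → ∑ (words n) (φ 1) ≡ (suc n) !
∑-words-φ₁ n = trans (sym (*-identityʳ (∑ (words n) (φ 1)))) (∑-words-φ n 1)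

-- This sums `φ-split` over `words`. Words without empty columns give the term with `0 !`; in the
-- other terms `(suc i) !` is the total weight `φ 1` of the right parts with `i` labels, and the cut
-- column accounts for the shift.
!⋆∑ψ : ∀ n → (_! ⋆ (λ j → ∑ (words j) ψ)) n ≡ (suc n) !
!⋆∑ψ zero    = refl
!⋆∑ψ (suc n) = begin
  1 * ∑ (words (suc n)) ψ + ((λ i → (suc i) !) ⋆ (λ j → ∑ (words j) ψ)) n
    ≡⟨ cong₂ _+_ (*-identityˡ (∑ (words (suc n)) ψ))
         (diag-cong n λ i j _ → cong (_* ∑ (words j) ψ) (sym (∑-words-φ₁ i))) ⟩
  ∑ (words (suc n)) ψ + ((λ i → ∑ (words i) (φ 1)) ⋆ (λ j → ∑ (words j) ψ)) n
    ≡⟨ cong (∑ (words (suc n)) ψ +_) (∑-words-⊙ n (φ 1) ψ) ⟨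
  ∑ (words (suc n)) ψ + ∑ (words (suc n)) (φ 1 ⊙ ψ)
    ≡⟨ ∑-+ ψ (φ 1 ⊙ ψ) (words (suc n)) ⟨
  ∑[ u ∈ words (suc n) ] (ψ u + (φ 1 ⊙ ψ) u)
    ≡⟨ ∑-cong φ-split (words (suc n)) ⟨
  ∑ (words (suc n)) (φ 1)
    ≡⟨ ∑-words-φ₁ (suc n) ⟩
  (suc (suc n)) ! ∎

-- Peeling off the first label of a tableau

-- In `unrestricted filled` and `restricted` the column contains a 1.
data Status : Set where
  row restricted : Status
  unrestricted   : Mark → Status

prepend : Status → Word → Word
prepend (unrestricted m) u = m ∷ u
prepend _                u = u

compress : ∀ {n} → Vec Status n → Word
compress []      = []
compress (t ∷ σ) = prepend t (compress σ)

hasOne : ∀ {n} → Vec (Maybe Bool) n → Bool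
hasOne []      = false
hasOne (e ∷ v) = fromMaybe false e ∨ hasOne v

-- The last argument tells whether the new row has a 1 to the left of the cell.
update : Step → Status → Maybe Bool → Bool → Maybe Status
update west  t                     nothing      _     = just t
update south row                   nothing      _     = just row
update south restricted            (just false) _     = just restricted
update south (unrestricted m)      (just true)  _     = just (unrestricted filled)
update south (unrestricted m)      (just false) false = just (unrestricted m)
update south (unrestricted filled) (just false) true  = just restricted
update _     _                     _            _     = nothing

-- Columns further left have larger labels, so the 1s to the left of the current cell are those of
-- the tail `v`.
updateRow : ∀ {n} → Step → Vec Status n → Vec (Maybe Bool) n → Maybe (Vec Status n)
updateRow s []      []      = just []
updateRow s (t ∷ σ) (e ∷ v) = Maybe.zipWith _∷_ (update s t e (hasOne v)) (updateRow s σ v)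

new : Step → Status
new south = row
new west  = unrestricted empty

-- Cells satisfy `r < c`, so no cell lies in the array column of the smallest label.
firstColumnEmpty : ∀ {n k} → Vec (Vec (Maybe Bool) (suc n)) k → Bool
firstColumnEmpty []                    = true
firstColumnEmpty ((nothing ∷ _) ∷ rows) = firstColumnEmpty rows
firstColumnEmpty ((just _ ∷ _) ∷ rows)  = false

-- `nothing` unless the array is a permutation tableau except that
-- unrestricted columns may be empty.
run : ∀ {n} → Diagram n → Vec (Vec (Maybe Bool) n) n → Maybe (Vec Status n)
run []      []         = just []
run (s ∷ d) (v ∷ rows) =
  if firstColumnEmpty (v ∷ rows)
  then run d (Vec.map tail rows) >>= (λ σ → Maybe.map (new s ∷_) (updateRow s σ (tail v)))
  else nothing

-- Rejected arrays weigh 0, so sums may run over all arrays and be evaluated entry by entry without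
-- a filter.
weight : ∀ {n} → (Word → ℕ) → Maybe (Vec Status n) → ℕ
weight W = maybe (W ∘ compress) 0

-- Summation over all arrays.

∑-rows-suc : ∀ n F → ∑ (vectors entries (suc n)) F ≡
  ∑[ v ∈ vectors entries n ] F (nothing ∷ v) +
  (∑[ v ∈ vectors entries n ] F (just false ∷ v) + ∑[ v ∈ vectors entries n ] F (just true ∷ v))
∑-rows-suc n F = trans (∑-vectors-suc entries n F)
  (cong (λ t → ∑ (vectors entries n) (F ∘ (nothing ∷_)) + (∑ (vectors entries n) (F ∘ (just false ∷_)) + t))
        (+-identityʳ _))

∑-firstColumnEmpty : ∀ n k G →
  ∑[ rows ∈ vectors (vectors entries (suc n)) k ]
    (if firstColumnEmpty rows then G (Vec.map tail rows) else 0) ≡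
  ∑ (vectors (vectors entries n) k) G
∑-firstColumnEmpty n zero    G = refl
∑-firstColumnEmpty n (suc k) G = begin
  ∑ (vectors (vectors entries (suc n)) (suc k)) H
    ≡⟨ ∑-vectors-suc (vectors entries (suc n)) k H ⟩
  ∑[ v ∈ vectors entries (suc n) ] ∑[ rows ∈ R ] H (v ∷ rows)
    ≡⟨ ∑-rows-suc n (λ v → ∑[ rows ∈ R ] H (v ∷ rows)) ⟩
  ∑[ v ∈ vectors entries n ] ∑[ rows ∈ R ] H ((nothing ∷ v) ∷ rows) +
    (∑[ v ∈ vectors entries n ] ∑[ rows ∈ R ] 0 + ∑[ v ∈ vectors entries n ] ∑[ rows ∈ R ] 0)
    ≡⟨ cong₂ _+_ (∑-cong (λ v → ∑-firstColumnEmpty n k (G ∘ (v ∷_))) (vectors entries n))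
                 (cong₂ _+_ ∑∑0≡0 ∑∑0≡0) ⟩
  ∑[ v ∈ vectors entries n ] ∑[ rows ∈ vectors (vectors entries n) k ] G (v ∷ rows) + 0
    ≡⟨ +-identityʳ _ ⟩
  ∑[ v ∈ vectors entries n ] ∑[ rows ∈ vectors (vectors entries n) k ] G (v ∷ rows)
    ≡⟨ ∑-vectors-suc (vectors entries n) k G ⟨
  ∑ (vectors (vectors entries n) (suc k)) G ∎
  where
  R = vectors (vectors entries (suc n)) k

  H : Vec (Vec (Maybe Bool) (suc n)) (suc k) → ℕ
  H rows = if firstColumnEmpty rows then G (Vec.map tail rows) else 0

  ∑∑0≡0 : ∑[ v ∈ vectors entries n ] ∑[ rows ∈ R ] 0 ≡ 0
  ∑∑0≡0 = trans (∑-cong (λ _ → ∑-zero R) (vectors entries n)) (∑-zero (vectors entries n))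

weight-∷ : ∀ {n} W t (σ? : Maybe (Vec Status n)) →
  weight W (Maybe.zipWith _∷_ (just t) σ?) ≡ weight (W ∘ prepend t) σ?
weight-∷ W t (just σ) = refl
weight-∷ W t nothing  = refl

weight-zero : ∀ {n} (σ? : Maybe (Vec Status n)) → weight (λ _ → 0) σ? ≡ 0
weight-zero (just σ) = refl
weight-zero nothing  = refl

∑-updateRow-west : ∀ {n} (σ : Vec Status n) W →
  ∑[ v ∈ vectors entries n ] weight W (updateRow west σ v) ≡ W (compress σ)
∑-updateRow-west []              W = +-identityʳ (W [])
∑-updateRow-west {suc n} (t ∷ σ) W = begin
  ∑[ v ∈ vectors entries (suc n) ] weight W (updateRow west (t ∷ σ) v)
    ≡⟨ ∑-rows-suc n (weight W ∘ updateRow west (t ∷ σ)) ⟩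
  ∑[ v ∈ R ] weight W (Maybe.zipWith _∷_ (just t) (updateRow west σ v)) + (∑[ v ∈ R ] 0 + ∑[ v ∈ R ] 0)
    ≡⟨ cong₂ _+_ (∑-cong (λ v → weight-∷ W t (updateRow west σ v)) R) (cong₂ _+_ (∑-zero R) (∑-zero R)) ⟩
  ∑[ v ∈ R ] weight (W ∘ prepend t) (updateRow west σ v) + 0
    ≡⟨ +-identityʳ _ ⟩
  ∑[ v ∈ R ] weight (W ∘ prepend t) (updateRow west σ v)
    ≡⟨ ∑-updateRow-west σ (W ∘ prepend t) ⟩
  W (prepend t (compress σ)) ∎
  where R = vectors entries n

-- A row of 0s leaves the word alone; a row with a 1 turns it into one of its `successors⁺`. Whether
-- a 0 restricts its column depends on the part of the row further left, so the induction needs a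
-- weight that may depend on `hasOne v`.
∑-updateRow-south : ∀ {n} (σ : Vec Status n) (G : Bool → Word → ℕ) →
  ∑[ v ∈ vectors entries n ] weight (G (hasOne v)) (updateRow south σ v) ≡
  G false (compress σ) + ∑ (successors⁺ (compress σ)) (G true)
∑-updateRow-south []                       G = refl
∑-updateRow-south {suc n} (row ∷ σ)        G = begin
  ∑[ v ∈ vectors entries (suc n) ] weight (G (hasOne v)) (updateRow south (row ∷ σ) v)
    ≡⟨ ∑-rows-suc n _ ⟩
  ∑[ v ∈ R ] weight (G (hasOne v)) (Maybe.zipWith _∷_ (just row) (updateRow south σ v)) +
    (∑[ v ∈ R ] 0 + ∑[ v ∈ R ] 0)
    ≡⟨ cong₂ _+_ (∑-cong (λ v → weight-∷ (G (hasOne v)) row (updateRow south σ v)) R)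
                 (cong₂ _+_ (∑-zero R) (∑-zero R)) ⟩
  ∑[ v ∈ R ] weight (G (hasOne v)) (updateRow south σ v) + 0
    ≡⟨ +-identityʳ _ ⟩
  ∑[ v ∈ R ] weight (G (hasOne v)) (updateRow south σ v)
    ≡⟨ ∑-updateRow-south σ G ⟩
  G false (compress σ) + ∑ (successors⁺ (compress σ)) (G true) ∎
  where R = vectors entries n
∑-updateRow-south {suc n} (restricted ∷ σ) G = begin
  ∑[ v ∈ vectors entries (suc n) ] weight (G (hasOne v)) (updateRow south (restricted ∷ σ) v)
    ≡⟨ ∑-rows-suc n _ ⟩
  ∑[ v ∈ R ] 0 +
    (∑[ v ∈ R ] weight (G (hasOne v)) (Maybe.zipWith _∷_ (just restricted) (updateRow south σ v)) + ∑[ v ∈ R ] 0)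
    ≡⟨ cong₂ _+_ (∑-zero R)
         (cong₂ _+_ (∑-cong (λ v → weight-∷ (G (hasOne v)) restricted (updateRow south σ v)) R) (∑-zero R)) ⟩
  ∑[ v ∈ R ] weight (G (hasOne v)) (updateRow south σ v) + 0
    ≡⟨ +-identityʳ _ ⟩
  ∑[ v ∈ R ] weight (G (hasOne v)) (updateRow south σ v)
    ≡⟨ ∑-updateRow-south σ G ⟩
  G false (compress σ) + ∑ (successors⁺ (compress σ)) (G true) ∎
  where R = vectors entries n
∑-updateRow-south {suc n} (unrestricted filled ∷ σ) G = begin
  ∑[ v ∈ vectors entries (suc n) ] weight (G (hasOne v)) (updateRow south (unrestricted filled ∷ σ) v)
    ≡⟨ ∑-rows-suc n _ ⟩
  ∑[ v ∈ R ] 0 +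
    (∑[ v ∈ R ] weight (G (hasOne v))
                  (Maybe.zipWith _∷_ (update south (unrestricted filled) (just false) (hasOne v)) (updateRow south σ v)) +
     ∑[ v ∈ R ] weight (G true) (Maybe.zipWith _∷_ (just (unrestricted filled)) (updateRow south σ v)))
    ≡⟨ cong₂ _+_ (∑-zero R)
         (cong₂ _+_ (∑-cong (λ v → zero-entry (hasOne v) (updateRow south σ v)) R)
                    (∑-cong (λ v → weight-∷ (G true) (unrestricted filled) (updateRow south σ v)) R)) ⟩
  ∑[ v ∈ R ] weight (G₀ (hasOne v)) (updateRow south σ v) +
  ∑[ v ∈ R ] weight (G₁ (hasOne v)) (updateRow south σ v)
    ≡⟨ cong₂ _+_ (∑-updateRow-south σ G₀) (∑-updateRow-south σ G₁) ⟩
  G false (filled ∷ u) + ∑ (successors⁺ u) (G true) +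
  (G true (filled ∷ u) + ∑ (successors⁺ u) (G true ∘ (filled ∷_)))
    ≡⟨ regroup (G false (filled ∷ u)) _ (G true (filled ∷ u)) _ ⟩
  G false (filled ∷ u) +
  (G true (filled ∷ u) + (∑ (successors⁺ u) (G true ∘ (filled ∷_)) + ∑ (successors⁺ u) (G true)))
    ≡⟨ cong (G false (filled ∷ u) +_) (∑-successors⁺-filled (G true) u) ⟨
  G false (filled ∷ u) + ∑ (successors⁺ (filled ∷ u)) (G true) ∎
  where
  R = vectors entries n
  u = compress σ

  -- These weigh the remaining row after a 0 and after a 1 in the current column. The Boolean
  -- concerns the remaining row only: after a 0 with a 1 to its left the column leaves the word, and
  -- after a 1 the whole row has a 1 in any case.
  G₀ G₁ : Bool → Word → ℕ
  G₀ true  = G true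
  G₀ false = G false ∘ (filled ∷_)
  G₁ _     = G true ∘ (filled ∷_)

  zero-entry : ∀ q (σ? : Maybe (Vec Status n)) →
    weight (G q) (Maybe.zipWith _∷_ (update south (unrestricted filled) (just false) q) σ?) ≡ weight (G₀ q) σ?
  zero-entry true  = weight-∷ (G true) restricted
  zero-entry false = weight-∷ (G false) (unrestricted filled)

  regroup : ∀ a b c d → a + b + (c + d) ≡ a + (c + (d + b))
  regroup = solve-∀
∑-updateRow-south {suc n} (unrestricted empty ∷ σ) G = begin
  ∑[ v ∈ vectors entries (suc n) ] weight (G (hasOne v)) (updateRow south (unrestricted empty ∷ σ) v)
    ≡⟨ ∑-rows-suc n _ ⟩
  ∑[ v ∈ R ] 0 +
    (∑[ v ∈ R ] weight (G (hasOne v))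
                  (Maybe.zipWith _∷_ (update south (unrestricted empty) (just false) (hasOne v)) (updateRow south σ v)) +
     ∑[ v ∈ R ] weight (G true) (Maybe.zipWith _∷_ (just (unrestricted filled)) (updateRow south σ v)))
    ≡⟨ cong₂ _+_ (∑-zero R)
         (cong₂ _+_ (∑-cong (λ v → zero-entry (hasOne v) (updateRow south σ v)) R)
                    (∑-cong (λ v → weight-∷ (G true) (unrestricted filled) (updateRow south σ v)) R)) ⟩
  ∑[ v ∈ R ] weight (G₀ (hasOne v)) (updateRow south σ v) +
  ∑[ v ∈ R ] weight (G₁ (hasOne v)) (updateRow south σ v)
    ≡⟨ cong₂ _+_ (∑-updateRow-south σ G₀) (∑-updateRow-south σ G₁) ⟩
  G false (empty ∷ u) + ∑ (successors⁺ u) (λ _ → 0) +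
  (G true (filled ∷ u) + ∑ (successors⁺ u) (G true ∘ (filled ∷_)))
    ≡⟨ cong₂ _+_ (trans (cong (G false (empty ∷ u) +_) (∑-zero (successors⁺ u))) (+-identityʳ _))
                 (sym (∑-successors⁺-empty (G true) u)) ⟩
  G false (empty ∷ u) + ∑ (successors⁺ (empty ∷ u)) (G true) ∎
  where
  R = vectors entries n
  u = compress σ

  G₀ G₁ : Bool → Word → ℕ
  -- Here a 0 with a 1 to its left would restrict an empty column, and `update` rejects it.
  G₀ true  = λ _ → 0
  G₀ false = G false ∘ (empty ∷_)
  G₁ _     = G true ∘ (filled ∷_)

  zero-entry : ∀ q (σ? : Maybe (Vec Status n)) →
    weight (G q) (Maybe.zipWith _∷_ (update south (unrestricted empty) (just false) q) σ?) ≡ weight (G₀ q) σ?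
  zero-entry true  σ? = sym (weight-zero σ?)
  zero-entry false σ? = weight-∷ (G false) (unrestricted empty) σ?

afterStep : Step → (Word → ℕ) → Word → ℕ
afterStep south W u = W u + ∑ (successors⁺ u) W
afterStep west  W u = W (empty ∷ u)

∑-step : ∀ {n} s W (σ? : Maybe (Vec Status n)) →
  ∑[ v ∈ vectors entries n ] weight W (σ? >>= λ σ → Maybe.map (new s ∷_) (updateRow s σ v)) ≡
  weight (afterStep s W) σ?
∑-step {n} s W nothing  = ∑-zero (vectors entries n)
∑-step {n} s W (just σ) =
  trans (∑-cong (λ v → weight-map (updateRow s σ v)) (vectors entries n)) (∑-updateRow s)
  where
  weight-map : ∀ σ? → weight W (Maybe.map (new s ∷_) σ?) ≡ weight (W ∘ prepend (new s)) σ?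
  weight-map (just _) = refl
  weight-map nothing  = refl

  ∑-updateRow : ∀ s → ∑[ v ∈ vectors entries n ] weight (W ∘ prepend (new s)) (updateRow s σ v) ≡
                afterStep s W (compress σ)
  ∑-updateRow south = ∑-updateRow-south σ λ _ → W
  ∑-updateRow west  = ∑-updateRow-west σ (W ∘ (empty ∷_))

-- The smallest label is peeled off, and `afterStep` is the effect of putting it back; its cases
-- `south` and `west` together make up `successors`. Each peeling changes the weight, so `W` is
-- arbitrary.
∑-run : ∀ n W → ∑[ T ∈ arrays n ] weight W (uncurry run T) ≡ ∑ (words n) W
∑-run zero    W = refl
∑-run (suc n) W = begin
  ∑[ T ∈ arrays (suc n) ] weight W (uncurry run T)
    ≡⟨ ∑-cartesianProductWith _ _,_ (vectors steps (suc n)) M⁺ ⟩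
  ∑[ d ∈ vectors steps (suc n) ] ∑[ m ∈ M⁺ ] weight W (run d m)
    ≡⟨ ∑-vectors-suc steps n (λ d → ∑[ m ∈ M⁺ ] weight W (run d m)) ⟩
  ∑[ s ∈ steps ] ∑[ d ∈ D ] ∑[ m ∈ M⁺ ] weight W (run (s ∷ d) m)
    ≡⟨ ∑-cong (λ s → trans (∑-cong (peel s) D) (∑-IH s)) steps ⟩
  ∑[ s ∈ steps ] ∑ (words n) (afterStep s W)
    ≡⟨ regroup (∑ (words n) (afterStep south W)) (∑ (words n) (afterStep west W)) ⟩
  ∑ (words n) (afterStep west W) + ∑ (words n) (afterStep south W)
    ≡⟨ ∑-+ (afterStep west W) (afterStep south W) (words n) ⟨
  ∑[ u ∈ words n ] ∑ (successors u) W
    ≡⟨ ∑-concatMap W successors (words n) ⟨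
  ∑ (words (suc n)) W ∎
  where
  D  = vectors steps n
  M  = vectors (vectors entries n) n
  M⁺ = vectors (vectors entries (suc n)) (suc n)

  next : Step → Diagram n → Vec (Maybe Bool) n → Vec (Vec (Maybe Bool) n) n → ℕ
  next s d v m = weight W (run d m >>= λ σ → Maybe.map (new s ∷_) (updateRow s σ v))

  G : Step → Diagram n → Vec (Vec (Maybe Bool) n) (suc n) → ℕ
  G s d (v ∷ m) = next s d v m

  weight-if : ∀ s d m → weight W (run (s ∷ d) m) ≡ (if firstColumnEmpty m then G s d (Vec.map tail m) else 0)
  weight-if s d (v ∷ rows) with firstColumnEmpty (v ∷ rows)
  ... | true  = refl
  ... | false = refl

  peel : ∀ s d → ∑[ m ∈ M⁺ ] weight W (run (s ∷ d) m) ≡ ∑[ m ∈ M ] weight (afterStep s W) (run d m)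
  peel s d = begin
    ∑[ m ∈ M⁺ ] weight W (run (s ∷ d) m)                            ≡⟨ ∑-cong (weight-if s d) M⁺ ⟩
    ∑[ m ∈ M⁺ ] (if firstColumnEmpty m then G s d (Vec.map tail m) else 0)
                                                                    ≡⟨ ∑-firstColumnEmpty n (suc n) (G s d) ⟩
    ∑ (vectors (vectors entries n) (suc n)) (G s d)                 ≡⟨ ∑-vectors-suc (vectors entries n) n (G s d) ⟩
    -- After the swap `run d m` is fixed while the new top row varies.
    ∑[ v ∈ vectors entries n ] ∑[ m ∈ M ] next s d v m              ≡⟨ ∑-swap (next s d) (vectors entries n) M ⟩
    ∑[ m ∈ M ] ∑[ v ∈ vectors entries n ] next s d v m              ≡⟨ ∑-cong (λ m → ∑-step s W (run d m)) M ⟩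
    ∑[ m ∈ M ] weight (afterStep s W) (run d m)                     ∎

  ∑-IH : ∀ s → ∑[ d ∈ D ] ∑[ m ∈ M ] weight (afterStep s W) (run d m) ≡ ∑ (words n) (afterStep s W)
  ∑-IH s = trans (sym (∑-cartesianProductWith _ _,_ D M)) (∑-run n (afterStep s W))

  regroup : ∀ a b → a + (b + 0) ≡ b + a
  regroup = solve-∀

-- Correctness of `run`.

-- `x` is the step of the label; `H` and `R` stand for its column having a 1, and having a 0 with a
-- 1 to its left. No status allows `R` without `H`: any 1 that such a column received later would
-- make that 0 forbidden.
IsStatus : Step → Set → Set → Status → Set
IsStatus x H R row                   = x ≡ south
IsStatus x H R restricted            = x ≡ west × H × R
IsStatus x H R (unrestricted filled) = x ≡ west × H × ¬ R
IsStatus x H R (unrestricted empty)  = x ≡ west × ¬ H × ¬ R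

IsStatus-resp : ∀ {x H H′ R R′} → H ⇔ H′ → R ⇔ R′ → ∀ t → IsStatus x H R t → IsStatus x H′ R′ t
IsStatus-resp H⇔ R⇔ row                   p             = p
IsStatus-resp H⇔ R⇔ restricted            (x , h , r)   = x , to H⇔ h , to R⇔ r
IsStatus-resp H⇔ R⇔ (unrestricted filled) (x , h , ¬r)  = x , to H⇔ h , ¬r ∘ from R⇔
IsStatus-resp H⇔ R⇔ (unrestricted empty)  (x , ¬h , ¬r) = x , ¬h ∘ from H⇔ , ¬r ∘ from R⇔

module _ {x : Step} {H R : Set} where

  CellFilled : Step → Maybe Bool → Set
  CellFilled s e = Is-just e ⇔ (s ≡ south × x ≡ west)

  H⁺ : Maybe Bool → Set
  H⁺ e = e ≡ just true ⊎ H

  R⁺ : Maybe Bool → Bool → Set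
  R⁺ e q = (e ≡ just false × q ≡ true) ⊎ R

  -- The local form of the tableau conditions when a row is put on top. Zeros of the new row have
  -- nothing above them, so the only new violation is a 1 above an older 0 with a 1 to its left,
  -- that is, `e ≡ just true` together with `R`.
  update-sound : ∀ s t e q {t′} → IsStatus x H R t → update s t e q ≡ just t′ →
    CellFilled s e × ¬ (e ≡ just true × R) × IsStatus x (H⁺ e) (R⁺ e q) t′
  update-sound west t nothing q p refl =
    mk⇔ (λ ()) (λ ()) , (λ ()) ,
    IsStatus-resp (mk⇔ inj₂ [ (λ ()) , id ]′) (mk⇔ inj₂ [ (λ ()) , id ]′) t p
  update-sound west t (just _) q p ()
  update-sound south row nothing q refl refl = mk⇔ (λ ()) (λ ()) , (λ ()) , refl
  update-sound south row (just _) q p ()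
  update-sound south restricted nothing q p ()
  update-sound south restricted (just true) q p ()
  update-sound south restricted (just false) q (refl , h , r) refl =
    mk⇔ (λ _ → refl , refl) (λ _ → MaybeAny.just tt) , (λ ()) , (refl , inj₂ h , inj₂ r)
  update-sound south (unrestricted m) nothing q p ()
  update-sound south (unrestricted filled) (just true) q (refl , h , ¬r) refl =
    mk⇔ (λ _ → refl , refl) (λ _ → MaybeAny.just tt) , ¬r ∘ proj₂ ,
    (refl , inj₁ refl , [ (λ ()) , ¬r ]′)
  update-sound south (unrestricted empty) (just true) q (refl , ¬h , ¬r) refl =
    mk⇔ (λ _ → refl , refl) (λ _ → MaybeAny.just tt) , ¬r ∘ proj₂ ,
    (refl , inj₁ refl , [ (λ ()) , ¬r ]′)
  update-sound south (unrestricted filled) (just false) false (refl , h , ¬r) refl =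
    mk⇔ (λ _ → refl , refl) (λ _ → MaybeAny.just tt) , (λ ()) ,
    (refl , inj₂ h , [ (λ ()) , ¬r ]′)
  update-sound south (unrestricted empty) (just false) false (refl , ¬h , ¬r) refl =
    mk⇔ (λ _ → refl , refl) (λ _ → MaybeAny.just tt) , (λ ()) ,
    (refl , [ (λ ()) , ¬h ]′ , [ (λ ()) , ¬r ]′)
  update-sound south (unrestricted filled) (just false) true (refl , h , ¬r) refl =
    mk⇔ (λ _ → refl , refl) (λ _ → MaybeAny.just tt) , (λ ()) ,
    (refl , inj₂ h , inj₁ (refl , refl))
  update-sound south (unrestricted empty) (just false) true p ()

  -- The last hypothesis excludes the one case in which the others would still let `update` fail: a
  -- 0 that restricts an empty column.
  update-complete : ∀ s t e q → IsStatus x H R t → CellFilled s e → ¬ (e ≡ just true × R) →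
    (x ≡ west → H⁺ e ⊎ ¬ R⁺ e q) → ∃ λ t′ → update s t e q ≡ just t′
  update-complete west t nothing q p cell ¬f g = t , refl
  update-complete west t (just _) q p cell ¬f g with () ← proj₁ (to cell (MaybeAny.just tt))
  update-complete south row nothing q p cell ¬f g = row , refl
  update-complete south row (just _) q refl cell ¬f g with () ← proj₂ (to cell (MaybeAny.just tt))
  update-complete south restricted nothing q (refl , _) cell ¬f g with () ← from cell (refl , refl)
  update-complete south restricted (just true) q (_ , _ , r) cell ¬f g = ⊥-elim (¬f (refl , r))
  update-complete south restricted (just false) q p cell ¬f g = restricted , refl
  update-complete south (unrestricted filled) nothing q (refl , _) cell ¬f g with () ← from cell (refl , refl)
  update-complete south (unrestricted empty) nothing q (refl , _) cell ¬f g with () ← from cell (refl , refl)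
  update-complete south (unrestricted m) (just true) q p cell ¬f g = unrestricted filled , refl
  update-complete south (unrestricted m) (just false) false p cell ¬f g = unrestricted m , refl
  update-complete south (unrestricted filled) (just false) true p cell ¬f g = restricted , refl
  update-complete south (unrestricted empty) (just false) true (refl , ¬h , _) cell ¬f g with g refl
  ... | inj₁ (inj₂ h) = ⊥-elim (¬h h)
  ... | inj₂ ¬r       = ⊥-elim (¬r (inj₁ (refl , refl)))

OneAfter : ∀ {n} → Vec (Maybe Bool) n → Fin n → Set
OneAfter v c = ∃ λ c′ → c Fin.< c′ × lookup v c′ ≡ just true

hasOneAfter : ∀ {n} → Vec (Maybe Bool) n → Fin n → Bool
hasOneAfter (e ∷ v) zero    = hasOne v
hasOneAfter (e ∷ v) (suc c) = hasOneAfter v c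

hasOne⇒∃ : ∀ {n} (v : Vec (Maybe Bool) n) → hasOne v ≡ true → ∃ λ c → lookup v c ≡ just true
hasOne⇒∃ (just true ∷ v)  _ = zero , refl
hasOne⇒∃ (just false ∷ v) p with c , q ← hasOne⇒∃ v p = suc c , q
hasOne⇒∃ (nothing ∷ v)    p with c , q ← hasOne⇒∃ v p = suc c , q

∃⇒hasOne : ∀ {n} (v : Vec (Maybe Bool) n) c → lookup v c ≡ just true → hasOne v ≡ true
∃⇒hasOne (_ ∷ v) zero    refl = refl
∃⇒hasOne (e ∷ v) (suc c) p    = trans (cong (fromMaybe false e ∨_) (∃⇒hasOne v c p)) (∨-zeroʳ _)

hasOneAfter⇔ : ∀ {n} (v : Vec (Maybe Bool) n) c → hasOneAfter v c ≡ true ⇔ OneAfter v c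
hasOneAfter⇔ (e ∷ v) zero    = mk⇔
  (λ p → suc (proj₁ (hasOne⇒∃ v p)) , z<s , proj₂ (hasOne⇒∃ v p))
  (λ { (suc c , _ , p) → ∃⇒hasOne v c p })
hasOneAfter⇔ (e ∷ v) (suc c) = mk⇔
  (λ p → suc (proj₁ (to (hasOneAfter⇔ v c) p)) , s<s (proj₁ (proj₂ (to (hasOneAfter⇔ v c) p))) ,
         proj₂ (proj₂ (to (hasOneAfter⇔ v c) p)))
  (λ { (suc c′ , c<c′ , p) → from (hasOneAfter⇔ v c) (c′ , s<s⁻¹ c<c′ , p) })

zipWith-just : ∀ (g : A → B → C) x? y? {z} → Maybe.zipWith g x? y? ≡ just z →
  ∃ λ x → ∃ λ y → x? ≡ just x × y? ≡ just y × z ≡ g x y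
zipWith-just g (just x) (just y) refl = x , y , refl , refl , refl
zipWith-just g (just x) nothing  ()
zipWith-just g nothing  y?       ()

updateRow-lookup : ∀ {n} s (σ : Vec Status n) v {σ′} → updateRow s σ v ≡ just σ′ →
  ∀ c → update s (lookup σ c) (lookup v c) (hasOneAfter v c) ≡ just (lookup σ′ c)
updateRow-lookup s (t ∷ σ) (e ∷ v) p c
  with t′ , σ′ , p₁ , p₂ , refl ← zipWith-just _∷_ (update s t e (hasOne v)) (updateRow s σ v) p
  with c
... | zero   = p₁
... | suc c′ = updateRow-lookup s σ v p₂ c′

updateRow-defined : ∀ {n} s (σ : Vec Status n) v →
  (∀ c → ∃ λ t′ → update s (lookup σ c) (lookup v c) (hasOneAfter v c) ≡ just t′) →
  ∃ λ σ′ → updateRow s σ v ≡ just σ′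
updateRow-defined s []      []      p = [] , refl
updateRow-defined s (t ∷ σ) (e ∷ v) p
  with t′ , p₁ ← p zero
  with σ′ , p₂ ← updateRow-defined s σ v (p ∘ suc)
  = t′ ∷ σ′ , cong₂ (Maybe.zipWith _∷_) p₁ p₂

module _ {n : ℕ} (T : Array n) where

  HasOne Restricted : Fin n → Set
  HasOne     c = ∃ λ r → One T r c
  Restricted c = ∃ λ r → Zero T r c × OneToLeft T r c

  -- Removing the top row can destroy `EveryColumnHasOne`; the last condition is a weaker one that
  -- is inherited.
  IsPartialTableau : Set
  IsPartialTableau = Fills T × NoForbiddenZero T ×
                     (∀ c → IsColumn (proj₁ T) c → HasOne c ⊎ ¬ Restricted c)

  HasStatuses : Vec Status n → Set
  HasStatuses σ = ∀ c → IsStatus (lookup (proj₁ T) c) (HasOne c) (Restricted c) (lookup σ c)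

firstColumnEmpty⇒nothing : ∀ {n k} (rows : Vec (Vec (Maybe Bool) (suc n)) k) →
  firstColumnEmpty rows ≡ true → ∀ r → lookup (lookup rows r) zero ≡ nothing
firstColumnEmpty⇒nothing ((nothing ∷ _) ∷ rows) p zero    = refl
firstColumnEmpty⇒nothing ((nothing ∷ _) ∷ rows) p (suc r) = firstColumnEmpty⇒nothing rows p r

nothing⇒firstColumnEmpty : ∀ {n k} (rows : Vec (Vec (Maybe Bool) (suc n)) k) →
  (∀ r → lookup (lookup rows r) zero ≡ nothing) → firstColumnEmpty rows ≡ true
nothing⇒firstColumnEmpty []                     p = refl
nothing⇒firstColumnEmpty ((nothing ∷ _) ∷ rows) p = nothing⇒firstColumnEmpty rows (p ∘ suc)
nothing⇒firstColumnEmpty ((just _ ∷ _) ∷ rows)  p with () ← p zero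

module Peel {n} (s : Step) (d : Diagram n) (e : Maybe Bool) (v : Vec (Maybe Bool) n)
            (rows : Vec (Vec (Maybe Bool) (suc n)) n) where

  T : Array (suc n)
  T = s ∷ d , (e ∷ v) ∷ rows

  T′ : Array n
  T′ = d , Vec.map tail rows

  entry-suc : ∀ r c → entry T (suc r) (suc c) ≡ entry T′ r c
  entry-suc r c = trans (lookup-suc (lookup rows r))
                        (cong (λ w → lookup w c) (sym (lookup-map r tail rows)))
    where
    lookup-suc : (w : Vec (Maybe Bool) (suc n)) → lookup w (suc c) ≡ lookup (tail w) c
    lookup-suc (_ ∷ _) = refl

  HasOne⇔ : ∀ c → HasOne T (suc c) ⇔ (lookup v c ≡ just true ⊎ HasOne T′ c)
  HasOne⇔ c = mk⇔
    (λ { (zero , p)  → inj₁ p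
       ; (suc r , p) → inj₂ (r , trans (sym (entry-suc r c)) p) })
    [ zero ,_ , (λ (r , p) → suc r , trans (entry-suc r c) p) ]′

  OneToLeft⇔ : ∀ r c → OneToLeft T (suc r) (suc c) ⇔ OneToLeft T′ r c
  OneToLeft⇔ r c = mk⇔
    (λ { (suc c′ , c<c′ , p) → c′ , s<s⁻¹ c<c′ , trans (sym (entry-suc r c′)) p })
    (λ (c′ , c<c′ , p) → suc c′ , s<s c<c′ , trans (entry-suc r c′) p)

  OneToLeft-zero⇔ : ∀ c → OneToLeft T zero (suc c) ⇔ OneAfter v c
  OneToLeft-zero⇔ c = mk⇔
    (λ { (suc c′ , c<c′ , p) → c′ , s<s⁻¹ c<c′ , p })
    (λ (c′ , c<c′ , p) → suc c′ , s<s c<c′ , p)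

  Restricted⇔ : ∀ c → Restricted T (suc c) ⇔
    ((lookup v c ≡ just false × hasOneAfter v c ≡ true) ⊎ Restricted T′ c)
  Restricted⇔ c = mk⇔
    (λ { (zero , z , l)  → inj₁ (z , from (hasOneAfter⇔ v c) (to (OneToLeft-zero⇔ c) l))
       ; (suc r , z , l) → inj₂ (r , trans (sym (entry-suc r c)) z , to (OneToLeft⇔ r c) l) })
    [ (λ (z , l) → zero , z , from (OneToLeft-zero⇔ c) (to (hasOneAfter⇔ v c) l))
    , (λ (r , z , l) → suc r , trans (entry-suc r c) z , from (OneToLeft⇔ r c) l) ]′

  OneAbove⇔ : ∀ r c → OneAbove T (suc r) (suc c) ⇔ (lookup v c ≡ just true ⊎ OneAbove T′ r c)
  OneAbove⇔ r c = mk⇔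
    (λ { (zero , _ , p)      → inj₁ p
       ; (suc r′ , r′<r , p) → inj₂ (r′ , s<s⁻¹ r′<r , trans (sym (entry-suc r′ c)) p) })
    [ (λ p → zero , z<s , p)
    , (λ (r′ , r′<r , p) → suc r′ , s<s r′<r , trans (entry-suc r′ c) p) ]′

  Fills⁻ : Fills T → Fills T′ × (∀ c → Is-just (lookup v c) ⇔ (s ≡ south × lookup d c ≡ west))
  Fills⁻ F =
    (λ r c → mk⇔
      (λ p → strip (to (F (suc r) (suc c)) (subst Is-just (sym (entry-suc r c)) p)))
      (λ (r-row , c-col , r<c) →
        subst Is-just (entry-suc r c) (from (F (suc r) (suc c)) (r-row , c-col , s<s r<c)))) ,
    (λ c → mk⇔ (λ p → proj₁ (to (F zero (suc c)) p) , proj₁ (proj₂ (to (F zero (suc c)) p)))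
               (λ (s-row , c-col) → from (F zero (suc c)) (s-row , c-col , z<s)))
    where
    strip : ∀ {r c} → HasCell (s ∷ d) (suc r) (suc c) → HasCell d r c
    strip (r-row , c-col , r<c) = r-row , c-col , s<s⁻¹ r<c

  Fills⇒nothing : Fills T → ∀ r → entry T r zero ≡ nothing
  Fills⇒nothing F r with entry T r zero | to (F r zero)
  ... | nothing | _ = refl
  ... | just _  | p with () ← proj₂ (proj₂ (p (MaybeAny.just tt)))

  NoForbiddenZero⁻ : NoForbiddenZero T →
    NoForbiddenZero T′ × (∀ c → ¬ (lookup v c ≡ just true × Restricted T′ c))
  NoForbiddenZero⁻ N =
    (λ (r , c , z , a , l) →
      N (suc r , suc c , trans (entry-suc r c) z , from (OneAbove⇔ r c) (inj₂ a) , from (OneToLeft⇔ r c) l)) ,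
    (λ c (p , r , z , l) →
      N (suc r , suc c , trans (entry-suc r c) z , from (OneAbove⇔ r c) (inj₁ p) , from (OneToLeft⇔ r c) l))

  module _ (first-empty : ∀ r → entry T r zero ≡ nothing) where

    nothing≢just : ∀ {r b} → ¬ entry T r zero ≡ just b
    nothing≢just {r} p with () ← trans (sym (first-empty r)) p

    Fills⁺ : Fills T′ → (∀ c → Is-just (lookup v c) ⇔ (s ≡ south × lookup d c ≡ west)) → Fills T
    Fills⁺ F C r zero = mk⇔
      (λ p → contradiction (subst Is-just (first-empty r) p) λ ())
      (λ ())
    Fills⁺ F C zero (suc c) = mk⇔
      (λ p → proj₁ (to (C c) p) , proj₂ (to (C c) p) , z<s)
      (λ (s-row , c-col , _) → from (C c) (s-row , c-col))
    Fills⁺ F C (suc r) (suc c) = mk⇔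
      (λ p → extend (to (F r c) (subst Is-just (entry-suc r c) p)))
      (λ (r-row , c-col , r<c) →
        subst Is-just (sym (entry-suc r c)) (from (F r c) (r-row , c-col , s<s⁻¹ r<c)))
      where
      extend : HasCell d r c → HasCell (s ∷ d) (suc r) (suc c)
      extend (r-row , c-col , r<c) = r-row , c-col , s<s r<c

    NoForbiddenZero⁺ : NoForbiddenZero T′ → (∀ c → ¬ (lookup v c ≡ just true × Restricted T′ c)) →
      NoForbiddenZero T
    NoForbiddenZero⁺ N C (r , zero , z , _) = nothing≢just {r} z
    NoForbiddenZero⁺ N C (suc r , suc c , z , a , l) with to (OneAbove⇔ r c) a
    ... | inj₁ p  = C c (p , r , trans (sym (entry-suc r c)) z , to (OneToLeft⇔ r c) l)
    ... | inj₂ a′ = N (r , c , trans (sym (entry-suc r c)) z , a′ , to (OneToLeft⇔ r c) l)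

    new-status : IsStatus s (HasOne T zero) (Restricted T zero) (new s)
    new-status = status-new s
      where
      status-new : ∀ s′ → IsStatus s′ (HasOne T zero) (Restricted T zero) (new s′)
      status-new south = refl
      status-new west  = refl , (λ (r , p) → nothing≢just {r} p) , (λ (r , p , _) → nothing≢just {r} p)

run-step : ∀ {n} s (d : Diagram n) v rows {σ⁺} → run (s ∷ d) (v ∷ rows) ≡ just σ⁺ →
  firstColumnEmpty (v ∷ rows) ≡ true ×
  ∃ λ σ → ∃ λ σ′ → run d (Vec.map tail rows) ≡ just σ × updateRow s σ (tail v) ≡ just σ′ × σ⁺ ≡ new s ∷ σ′
run-step s d v rows p with firstColumnEmpty (v ∷ rows) | p
... | false | ()
... | true  | p with run d (Vec.map tail rows) | p
... | nothing | ()
... | just σ  | p with updateRow s σ (tail v) in eq | p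
... | nothing | ()
... | just σ′ | refl = refl , σ , σ′ , refl , eq , refl

run-sound : ∀ {n} (d : Diagram n) m {σ} → run d m ≡ just σ →
  Fills (d , m) × NoForbiddenZero (d , m) × HasStatuses (d , m) σ
run-sound []      []               refl = (λ ()) , (λ ()) , λ ()
run-sound (s ∷ d) ((e ∷ v) ∷ rows) p
  with fce , σ , σ′ , run≡ , upd≡ , refl ← run-step s d (e ∷ v) rows p
  with F , N , S ← run-sound d (Vec.map tail rows) run≡
  = Fills⁺ first-empty F (proj₁ ∘ column) ,
    NoForbiddenZero⁺ first-empty N (proj₁ ∘ proj₂ ∘ column) ,
    λ { zero    → new-status first-empty
      ; (suc c) → IsStatus-resp (⇔-sym (HasOne⇔ c)) (⇔-sym (Restricted⇔ c)) (lookup σ′ c)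
                    (proj₂ (proj₂ (column c))) }
  where
  open Peel s d e v rows

  first-empty : ∀ r → entry T r zero ≡ nothing
  first-empty = firstColumnEmpty⇒nothing ((e ∷ v) ∷ rows) fce

  column : ∀ c → _
  column c = update-sound s (lookup σ c) (lookup v c) (hasOneAfter v c) (S c)
               (updateRow-lookup s σ v upd≡ c)

run-complete : ∀ {n} (d : Diagram n) m → IsPartialTableau (d , m) → ∃ λ σ → run d m ≡ just σ
run-complete []      []               _           = [] , refl
run-complete (s ∷ d) ((e ∷ v) ∷ rows) (F , N , G)
  with F′ , cells ← Peel.Fills⁻ s d e v rows F
  with N′ , allowed ← Peel.NoForbiddenZero⁻ s d e v rows N
  with σ , run≡ ← run-complete d (Vec.map tail rows) (F′ , N′ , λ c c-col →
         -- If the 1 of the column lies in the removed row, the rest of the column cannot be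
         -- restricted: the 0 responsible would be forbidden.
         [ (λ h → [ (λ p → inj₂ λ r → allowed c (p , r)) , inj₁ ]′ (to (Peel.HasOne⇔ s d e v rows c) h))
         , (λ ¬r → inj₂ λ r → ¬r (from (Peel.Restricted⇔ s d e v rows c) (inj₂ r)))
         ]′ (G (suc c) c-col))
  with _ , _ , S ← run-sound d (Vec.map tail rows) run≡
  with σ′ , upd≡ ← updateRow-defined s σ v (λ c →
         update-complete s (lookup σ c) (lookup v c) (hasOneAfter v c) (S c) (cells c) (allowed c)
           λ c-col → Sum.map (to (Peel.HasOne⇔ s d e v rows c))
                             (λ ¬r → ¬r ∘ from (Peel.Restricted⇔ s d e v rows c))
                             (G (suc c) c-col))
  rewrite nothing⇒firstColumnEmpty ((e ∷ v) ∷ rows) (Peel.Fills⇒nothing s d e v rows F)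
        | run≡ | upd≡
  = new s ∷ σ′ , refl

-- From statuses to the weight 2 ^ urc.

ψ-compress-zero : ∀ {n} (σ : Vec Status n) c → lookup σ c ≡ unrestricted empty → ψ (compress σ) ≡ 0
ψ-compress-zero (_ ∷ σ) zero refl = refl
ψ-compress-zero (row ∷ σ)                   (suc c) p = ψ-compress-zero σ c p
ψ-compress-zero (restricted ∷ σ)            (suc c) p = ψ-compress-zero σ c p
ψ-compress-zero (unrestricted empty ∷ σ)    (suc c) p = refl
ψ-compress-zero (unrestricted filled ∷ σ)   (suc c) p = cong (2 *_) (ψ-compress-zero σ c p)

isEmpty? : ∀ t → Dec (t ≡ unrestricted empty)
isEmpty? row                   = no λ ()
isEmpty? restricted            = no λ ()
isEmpty? (unrestricted filled) = no λ ()
isEmpty? (unrestricted empty)  = yes refl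

length-filter-tabulate : ∀ {P : A → Set} (P? : Decidable P) {n} (g : Fin n → A) →
  length (filter P? (tabulate g)) ≡ length (filter (P? ∘ g) (allFin n))
length-filter-tabulate P? {zero}  g = refl
length-filter-tabulate P? {suc n} g with P? (g zero)
... | yes _ = cong suc (trans (length-filter-tabulate P? (g ∘ suc)) (sym (length-filter-tabulate (P? ∘ g) suc)))
... | no  _ = trans (length-filter-tabulate P? (g ∘ suc)) (sym (length-filter-tabulate (P? ∘ g) suc))

ψ-compress : ∀ {n} (σ : Vec Status n) {P : Fin n → Set} (P? : Decidable P) →
  (∀ c → P c ⇔ lookup σ c ≡ unrestricted filled) → (∀ c → ¬ lookup σ c ≡ unrestricted empty) →
  ψ (compress σ) ≡ 2 ^ length (filter P? (allFin n))
ψ-compress []      P? P⇔ ¬e = refl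
ψ-compress {suc n} (t ∷ σ) P? P⇔ ¬e
  with IH ← trans (ψ-compress σ (P? ∘ suc) (P⇔ ∘ suc) (¬e ∘ suc))
                  (cong (2 ^_) (sym (length-filter-tabulate P? suc)))
  with t | P? zero | P⇔ zero | ¬e zero
... | row                 | yes p | e | _ with () ← to e p
... | restricted          | yes p | e | _ with () ← to e p
... | row                 | no _  | _ | _ = IH
... | restricted          | no _  | _ | _ = IH
... | unrestricted empty  | _     | _ | ¬e₀ = ⊥-elim (¬e₀ refl)
... | unrestricted filled | yes _ | _ | _ = cong (2 *_) IH
... | unrestricted filled | no ¬p | e | _ = ⊥-elim (¬p (from e refl))

-- `run` also accepts arrays that are not permutation tableaux; by `run-sound` these have an empty
-- column, so `ψ` vanishes on them. In a tableau no column is empty, so the unrestricted columns are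
-- exactly the letters `filled`, each giving a factor 2.
weight-run : ∀ {n} (T : Array n) (PT? : Dec (IsPermutationTableau T)) σ? → uncurry run T ≡ σ? →
  (if does PT? then 2 ^ urc T else 0) ≡ weight ψ σ?
weight-run (d , m) (yes (F , H , N)) nothing run≡
  with _ , eq ← run-complete d m (F , N , λ c c-col → inj₁ (H c c-col))
  with () ← trans (sym run≡) eq
weight-run _ (no _) nothing _ = refl
weight-run T@(d , m) (yes (F , H , N)) (just σ) run≡
  with _ , _ , S ← run-sound d m run≡
  = sym (ψ-compress σ (isUnrestrictedColumn? T) unrestricted⇔ ¬empty)
  where
  ¬empty : ∀ c → ¬ lookup σ c ≡ unrestricted empty
  ¬empty c p with lookup σ c | p | S c
  ... | _ | refl | (c-col , ¬h , _) = ¬h (H c c-col)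

  unrestricted⇔ : ∀ c → IsUnrestrictedColumn T c ⇔ lookup σ c ≡ unrestricted filled
  unrestricted⇔ c with lookup σ c | S c | ¬empty c
  ... | row                 | c-row            | _  =
    mk⇔ (λ (c-col , _) → contradiction (trans (sym c-row) c-col) λ ()) (λ ())
  ... | restricted          | (_ , _ , r)      | _  = mk⇔ (λ (_ , ¬r) → ⊥-elim (¬r r)) (λ ())
  ... | unrestricted filled | (c-col , _ , ¬r) | _  = mk⇔ (λ _ → refl) (λ _ → c-col , ¬r)
  ... | unrestricted empty  | _                | ¬e = ⊥-elim (¬e refl)
weight-run T@(d , m) (no ¬PT) (just σ) run≡
  with F , N , S ← run-sound d m run≡
  with Fin.any? (isEmpty? ∘ lookup σ)
... | yes (c , p) = sym (ψ-compress-zero σ c p)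
... | no ¬empty   = ⊥-elim (¬PT (F , everyColumnHasOne , N))
  where
  everyColumnHasOne : EveryColumnHasOne T
  everyColumnHasOne c c-col with lookup σ c in eq | S c
  ... | row                 | c-row       = contradiction (trans (sym c-row) c-col) λ ()
  ... | restricted          | (_ , h , _) = h
  ... | unrestricted filled | (_ , h , _) = h
  ... | unrestricted empty  | _           = ⊥-elim (¬empty (c , eq))

∑-𝒫𝒯 : ∀ n → ∑[ T ∈ 𝒫𝒯 n ] (2 ^ urc T) ≡ ∑ (words n) ψ
∑-𝒫𝒯 n = trans (∑-filter isPermutationTableau? (λ T → 2 ^ urc T) (arrays n))
          (trans (∑-cong (λ T → weight-run T (isPermutationTableau? T) (uncurry run T) refl) (arrays n)) (∑-run n ψ))

-- Connected permutations

-- `F j` says that `j` is the least index with `Q`, so at most one term of the sum is 1, and one is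
-- as soon as `Q` holds somewhere up to `n`.
diag-first : ∀ {F Q : ℕ → Set} (F? : Decidable F) (Q? : Decidable Q) →
  (∀ j → F j ⇔ (Q j × ∀ {i} → i < j → ¬ Q i)) →
  ∀ n → diag (λ _ j → χ (F? j)) n ≡ χ (anyUpTo? Q? (suc n))
diag-first F? Q? F⇔ zero = χ-⇔
  (mk⇔ (λ p → 0 , s≤s z≤n , proj₁ (to (F⇔ 0) p))
       (λ { (zero , _ , q) → from (F⇔ 0) (q , λ ()) ; (suc _ , s≤s () , _) }))
  (F? 0) (anyUpTo? Q? 1)
diag-first {F} {Q} F? Q? F⇔ (suc n) =
  trans (cong (χ (F? (suc n)) +_) (diag-first F? Q? F⇔ n)) (step (anyUpTo? Q? (suc n)) (Q? (suc n)))
  where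
  step : (E? : Dec (∃ λ j → j < suc n × Q j)) → Dec (Q (suc n)) →
         χ (F? (suc n)) + χ E? ≡ χ (anyUpTo? Q? (suc (suc n)))
  step (yes (j , j≤n , q)) _ =
    trans (cong (_+ 1) (χ-no (F? (suc n)) λ p → proj₂ (to (F⇔ (suc n)) p) j≤n q))
          (sym (χ-yes (anyUpTo? Q? (suc (suc n))) (j , m≤n⇒m≤1+n j≤n , q)))
  step (no ¬e) (yes q) =
    trans (cong (_+ 0) (χ-yes (F? (suc n)) (from (F⇔ (suc n)) (q , λ i≤n q′ → ¬e (_ , i≤n , q′)))))
          (sym (χ-yes (anyUpTo? Q? (suc (suc n))) (suc n , n<1+n (suc n) , q)))
  step (no ¬e) (no ¬q) =
    trans (cong (_+ 0) (χ-no (F? (suc n)) (¬q ∘ proj₁ ∘ to (F⇔ (suc n)))))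
          (sym (χ-no (anyUpTo? Q? (suc (suc n))) λ (j , j<2+n , q) →
            [ (λ j<1+n → ¬e (j , j<1+n , q)) , (λ { refl → ¬q q }) ]′ (m<1+n⇒m<n∨m≡n j<2+n)))

-- Sums over words in a finite alphabet.

∑-vectors-take-drop : ∀ (X : List A) k l (g h : List A → ℕ) →
  ∑[ w ∈ vectors X (k + l) ] (g (take k (toList w)) * h (drop k (toList w))) ≡
  ∑[ u ∈ vectors X k ] g (toList u) * ∑[ v ∈ vectors X l ] h (toList v)
∑-vectors-take-drop X zero    l g h =
  trans (∑-*ˡ (g []) (h ∘ toList) (vectors X l))
        (cong (_* ∑[ v ∈ vectors X l ] h (toList v)) (sym (+-identityʳ (g []))))
∑-vectors-take-drop X (suc k) l g h = begin
  ∑[ w ∈ vectors X (suc k + l) ] (g (take (suc k) (toList w)) * h (drop (suc k) (toList w)))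
    ≡⟨ ∑-vectors-suc X (k + l) _ ⟩
  ∑[ x ∈ X ] ∑[ w ∈ vectors X (k + l) ] (g (x ∷ take k (toList w)) * h (drop k (toList w)))
    ≡⟨ ∑-cong (λ x → ∑-vectors-take-drop X k l (g ∘ (x ∷_)) h) X ⟩
  ∑[ x ∈ X ] (∑[ u ∈ vectors X k ] g (x ∷ toList u) * ∑[ v ∈ vectors X l ] h (toList v))
    ≡⟨ ∑-*ʳ _ _ X ⟩
  ∑[ x ∈ X ] ∑[ u ∈ vectors X k ] g (x ∷ toList u) * ∑[ v ∈ vectors X l ] h (toList v)
    ≡⟨ cong (_* ∑[ v ∈ vectors X l ] h (toList v)) (∑-vectors-suc X k (g ∘ toList)) ⟨
  ∑[ u ∈ vectors X (suc k) ] g (toList u) * ∑[ v ∈ vectors X l ] h (toList v) ∎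

-- This serves to shrink the alphabet: a connected permutation of length `k`, found as a prefix of a
-- longer word, has no letters above `k`.
∑-vectors-++ : ∀ (X Z : List A) m (F : List A → ℕ) → (∀ {w} → Any (_∈ Z) w → F w ≡ 0) →
  ∑[ w ∈ vectors (X ++ Z) m ] F (toList w) ≡ ∑[ w ∈ vectors X m ] F (toList w)
∑-vectors-++ X Z zero    F F≡0 = refl
∑-vectors-++ X Z (suc m) F F≡0 = begin
  ∑[ w ∈ vectors (X ++ Z) (suc m) ] F (toList w)
    ≡⟨ ∑-vectors-suc (X ++ Z) m (F ∘ toList) ⟩
  ∑[ x ∈ X ++ Z ] ∑[ w ∈ vectors (X ++ Z) m ] F (x ∷ toList w)
    ≡⟨ ∑-++ _ X Z ⟩
  ∑[ x ∈ X ] ∑[ w ∈ vectors (X ++ Z) m ] F (x ∷ toList w) +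
  ∑[ x ∈ Z ] ∑[ w ∈ vectors (X ++ Z) m ] F (x ∷ toList w)
    ≡⟨ cong₂ _+_ (∑-cong (λ x → ∑-vectors-++ X Z m (F ∘ (x ∷_)) (F≡0 ∘ there)) X)
         (trans (∑-cong-∈ Z λ x∈Z → trans (∑-cong (λ w → F≡0 (here x∈Z)) (vectors (X ++ Z) m))
                                          (∑-zero (vectors (X ++ Z) m)))
                (∑-zero Z)) ⟩
  ∑[ x ∈ X ] ∑[ w ∈ vectors X m ] F (x ∷ toList w) + 0
    ≡⟨ +-identityʳ _ ⟩
  ∑[ x ∈ X ] ∑[ w ∈ vectors X m ] F (x ∷ toList w)
    ≡⟨ ∑-vectors-suc X m (F ∘ toList) ⟨
  ∑[ w ∈ vectors X (suc m) ] F (toList w) ∎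

open DecMembership _≟_ using (_∈?_)

Unique-resp-↭ : ∀ {xs ys : List A} → xs ↭ ys → Unique xs → Unique ys
Unique-resp-↭ {A} xs↭ys = SetoidPermutation.Unique-resp-↭ (setoid A) (↭⇒↭ₛ xs↭ys)

∑-∈? : ∀ {X xs} → Unique X → Unique xs → (∀ {x} → x ∈ xs → x ∈ X) → ∑[ x ∈ X ] χ (x ∈? xs) ≡ length xs
∑-∈? {X} {xs} X! xs! xs⊆X = trans (sym (length-filter≡∑χ (_∈? xs) X))
  (↭-length (∼bag⇒↭ (unique∧set⇒bag (Unique.filter⁺ (_∈? xs) X!) xs!
    (mk⇔ (proj₂ ∘ ∈-filter⁻ (_∈? xs) {xs = X}) (λ x∈xs → ∈-filter⁺ (_∈? xs) (xs⊆X x∈xs) x∈xs)))))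

-- Counting by the first letter: it is one of the `suc m` members of `xs`, and what follows
-- rearranges the others. The alphabet `X` may exceed `xs`, as it does for a `block`.
∑-↭ : ∀ {X} → Unique X → ∀ m {xs} → Unique xs → (∀ {x} → x ∈ xs → x ∈ X) → length xs ≡ m →
  ∑[ w ∈ vectors X m ] χ (toList w ↭? xs) ≡ m !
∑-↭ {X} X! zero    {[]} xs! xs⊆X refl = refl
∑-↭ {X} X! (suc m) {xs} xs! xs⊆X len  = begin
  ∑[ w ∈ vectors X (suc m) ] χ (toList w ↭? xs)
    ≡⟨ ∑-vectors-suc X m _ ⟩
  ∑[ x ∈ X ] ∑[ w ∈ vectors X m ] χ ((x ∷ toList w) ↭? xs)
    ≡⟨ ∑-cong (λ x → first-letter x (x ∈? xs)) X ⟩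
  ∑[ x ∈ X ] (χ (x ∈? xs) * m !)
    ≡⟨ ∑-*ʳ (m !) (λ x → χ (x ∈? xs)) X ⟩
  ∑[ x ∈ X ] χ (x ∈? xs) * m !
    ≡⟨ cong (_* m !) (trans (∑-∈? X! xs! xs⊆X) len) ⟩
  suc m * m ! ∎
  where
  first-letter : ∀ x (x∈? : Dec (x ∈ xs)) →
    ∑[ w ∈ vectors X m ] χ ((x ∷ toList w) ↭? xs) ≡ χ x∈? * m !
  first-letter x (no x∉xs) =
    trans (∑-cong (λ w → χ-no ((x ∷ toList w) ↭? xs) λ p → x∉xs (∈-resp-↭ p (here refl))) (vectors X m))
          (∑-zero (vectors X m))
  first-letter x (yes x∈xs) with as , bs , refl ← ∈-∃++ x∈xs
    with _ ∷ rest! ← Unique-resp-↭ (shift x as bs) xs! = begin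
    ∑[ w ∈ vectors X m ] χ ((x ∷ toList w) ↭? (as ++ x ∷ bs))
      ≡⟨ ∑-cong (λ w → χ-⇔ (mk⇔ (λ p → drop-∷ (↭-trans p (shift x as bs)))
                                 (λ p → ↭-trans (prep x p) (↭-sym (shift x as bs))))
                            ((x ∷ toList w) ↭? (as ++ x ∷ bs)) (toList w ↭? (as ++ bs))) (vectors X m) ⟩
    ∑[ w ∈ vectors X m ] χ (toList w ↭? (as ++ bs))
      ≡⟨ ∑-↭ X! m rest! (xs⊆X ∘ ∈-resp-↭ (↭-sym (shift x as bs)) ∘ there)
           (suc-injective (trans (sym (↭-length (shift x as bs))) len)) ⟩
    m !
      ≡⟨ +-identityʳ (m !) ⟨
    1 * m ! ∎

-- The first component of a permutation and the recurrence for `f`.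

applyUpTo-+ : ∀ (g : ℕ → A) k l → applyUpTo g (k + l) ≡ applyUpTo g k ++ applyUpTo (g ∘ (k +_)) l
applyUpTo-+ g zero    l = refl
applyUpTo-+ g (suc k) l = cong (g 0 ∷_) (applyUpTo-+ (g ∘ suc) k l)

-- The letters left over after a first component of size `k`. They keep their values instead of
-- being standardised, so a word is just the concatenation of its two parts.
block : ℕ → ℕ → List ℕ
block k l = applyUpTo (λ j → suc (k + j)) l

[1⋯]≡block : ∀ m → [1⋯ m ] ≡ block 0 m
[1⋯]≡block = map-upTo suc

[1⋯+] : ∀ k l → [1⋯ k + l ] ≡ [1⋯ k ] ++ block k l
[1⋯+] k l = trans ([1⋯]≡block (k + l))
  (trans (applyUpTo-+ suc k l) (cong (_++ block k l) (sym ([1⋯]≡block k))))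

block! : ∀ k l → Unique (block k l)
block! k l = Unique.applyUpTo⁺₁ _ l λ i<j _ p → <⇒≢ i<j (+-cancelˡ-≡ k _ _ (suc-injective p))

[1⋯]! : ∀ m → Unique [1⋯ m ]
[1⋯]! m = subst Unique (sym ([1⋯]≡block m)) (block! 0 m)

length-[1⋯] : ∀ m → length [1⋯ m ] ≡ m
length-[1⋯] m = trans (cong length ([1⋯]≡block m)) (length-applyUpTo suc m)

[1⋯]-block-disjoint : ∀ {k l x} → x ∈ [1⋯ k ] → ¬ x ∈ block k l
[1⋯]-block-disjoint {k} {l} {x} p q
  with i , i<k , refl ← ∈-applyUpTo⁻ suc (subst (x ∈_) ([1⋯]≡block k) p)
  with j , _ , eq ← ∈-applyUpTo⁻ (λ j → suc (k + j)) {n = l} q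
  = <⇒≢ (<-≤-trans i<k (m≤m+n k j)) (suc-injective eq)

++-cancelˡ-↭ : ∀ (xs : List A) {ys zs} → xs ++ ys ↭ xs ++ zs → ys ↭ zs
++-cancelˡ-↭ []       p = p
++-cancelˡ-↭ (x ∷ xs) p = ++-cancelˡ-↭ xs (drop-∷ p)

-- Stated for lists so that it applies to a prefix `take k w`.
IsConnected : ℕ → List ℕ → Set
IsConnected m w = IsPermutation m w × ¬ (∃ λ k → k < m × 1 ≤ k × IsPermutation k (take k w))

isConnected? : ∀ m → Decidable (IsConnected m)
isConnected? m w = (w ↭? [1⋯ m ]) ×-dec
  ¬? (anyUpTo? (λ k → 1 ≤? k ×-dec (take k w ↭? [1⋯ k ])) m)

f≡∑ : ∀ m → f m ≡ ∑[ w ∈ vectors [1⋯ m ] m ] χ (isConnected? m (toList w))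
f≡∑ m = trans (length-filter≡∑χ (isConnectedPermutation? m) (vectors [1⋯ m ] m))
  (∑-cong (λ w → χ-⇔ (mk⇔ id id) (isConnectedPermutation? m w) (isConnected? m (toList w)))
          (vectors [1⋯ m ] m))

∑-connected : ∀ k l → ∑[ w ∈ vectors [1⋯ k + l ] k ] χ (isConnected? k (toList w)) ≡ f k
∑-connected k l = begin
  ∑[ w ∈ vectors [1⋯ k + l ] k ] χ (isConnected? k (toList w))
    ≡⟨ cong (λ X → ∑[ w ∈ vectors X k ] χ (isConnected? k (toList w))) ([1⋯+] k l) ⟩
  ∑[ w ∈ vectors ([1⋯ k ] ++ block k l) k ] χ (isConnected? k (toList w))
    ≡⟨ ∑-vectors-++ [1⋯ k ] (block k l) k (λ w → χ (isConnected? k w))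
         (λ {w} large → χ-no (isConnected? k w) λ (p , _) → small (Any-resp-↭ p large)) ⟩
  ∑[ w ∈ vectors [1⋯ k ] k ] χ (isConnected? k (toList w))
    ≡⟨ f≡∑ k ⟨
  f k ∎
  where
  small : ¬ Any (_∈ block k l) [1⋯ k ]
  small p with x , x∈ , x∈block ← find p = [1⋯]-block-disjoint x∈ x∈block

∑-block : ∀ k l → ∑[ w ∈ vectors [1⋯ k + l ] l ] χ (toList w ↭? block k l) ≡ l !
∑-block k l = ∑-↭ ([1⋯]! (k + l)) l (block! k l)
  (λ x∈ → subst (_ ∈_) (sym ([1⋯+] k l)) (∈-++⁺ʳ [1⋯ k ] x∈)) (length-applyUpTo _ l)

PrefixPermutation : List ℕ → ℕ → Set
PrefixPermutation w j = IsPermutation (suc j) (take (suc j) w)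

-- A prefix of a prefix is a prefix of `w`, so a connected prefix is the shortest nonempty one that
-- is a permutation. The index `j` stands for the length `suc j`, which leaves out the empty prefix.
isConnected-prefix⇔ : ∀ w j → IsConnected (suc j) (take (suc j) w) ⇔
  (PrefixPermutation w j × ∀ {i} → i < j → ¬ PrefixPermutation w i)
isConnected-prefix⇔ w j = mk⇔
  (λ (p , ¬q) → p , λ {i} i<j q →
    ¬q (suc i , s≤s i<j , s≤s z≤n , subst (IsPermutation (suc i)) (sym (prefix (s≤s (<⇒≤ i<j)))) q))
  (λ (p , ¬q) → p , λ { (suc i , s≤s i<j , _ , q) →
    ¬q i<j (subst (IsPermutation (suc i)) (prefix (s≤s (<⇒≤ i<j))) q) })
  where
  prefix : ∀ {i k} → i ≤ k → take i (take k w) ≡ take i w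
  prefix {i} {k} i≤k = trans (take-take i k w) (cong (λ l → take l w) (m≤n⇒m⊓n≡m i≤k))

-- A permutation has exactly one first component, and what follows it must use the remaining
-- letters, so one term is 1. If `w` is not a permutation every term vanishes, since two matching
-- parts would make it one.
first-component : ∀ n w → length w ≡ suc n → χ (w ↭? [1⋯ suc n ]) ≡
  diag (λ i j → χ (isConnected? (suc j) (take (suc j) w)) * χ (drop (suc j) w ↭? block (suc j) i)) n
first-component n w len with w ↭? [1⋯ suc n ]
... | yes w↭ = sym (begin
  diag (λ i j → χ (C? j) * χ (D? i j)) n
    ≡⟨ diag-cong n (λ i j i+j≡n → absorb i j (rest i j i+j≡n) (C? j)) ⟩
  diag (λ _ j → χ (C? j)) n
    ≡⟨ diag-first C? (λ j → take (suc j) w ↭? [1⋯ suc j ]) (isConnected-prefix⇔ w) n ⟩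
  χ (anyUpTo? (λ j → take (suc j) w ↭? [1⋯ suc j ]) (suc n))
    ≡⟨ χ-yes (anyUpTo? (λ j → take (suc j) w ↭? [1⋯ suc j ]) (suc n))
         -- The whole word is a prefix of itself, whence the witness `n`.
         (n , n<1+n n , subst (_↭ [1⋯ suc n ]) (sym (take-all (suc n) w (≤-reflexive len))) w↭) ⟩
  1 ∎)
  where
  C? : ∀ j → Dec (IsConnected (suc j) (take (suc j) w))
  C? j = isConnected? (suc j) (take (suc j) w)

  D? : ∀ i j → Dec (drop (suc j) w ↭ block (suc j) i)
  D? i j = drop (suc j) w ↭? block (suc j) i

  rest : ∀ i j → i + j ≡ n → IsConnected (suc j) (take (suc j) w) → drop (suc j) w ↭ block (suc j) i
  rest i j refl (p , _) = ++-cancelˡ-↭ [1⋯ suc j ]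
    (↭-trans (++⁺ʳ (drop (suc j) w) (↭-sym p))
    (↭-trans (↭-reflexive (take++drop≡id (suc j) w))
    (↭-trans w↭ (↭-reflexive (trans (cong (λ k → [1⋯ suc k ]) (+-comm i j)) ([1⋯+] (suc j) i))))))

  absorb : ∀ i j → (IsConnected (suc j) (take (suc j) w) → drop (suc j) w ↭ block (suc j) i) →
           (c? : Dec (IsConnected (suc j) (take (suc j) w))) → χ c? * χ (D? i j) ≡ χ c?
  absorb i j c⇒d (yes c) = trans (+-identityʳ _) (χ-yes (D? i j) (c⇒d c))
  absorb i j c⇒d (no _)  = refl
... | no ¬w↭ = sym (trans (diag-cong n λ i j i+j≡n →
    vanish i j i+j≡n (isConnected? (suc j) (take (suc j) w)) (drop (suc j) w ↭? block (suc j) i))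
    (diag-zero n))
  where
  vanish : ∀ i j → i + j ≡ n → (c? : Dec (IsConnected (suc j) (take (suc j) w)))
    (d? : Dec (drop (suc j) w ↭ block (suc j) i)) → χ c? * χ d? ≡ 0
  vanish i j i+j≡n (no _)        d?      = refl
  vanish i j i+j≡n (yes _)       (no _)  = refl
  vanish i j refl  (yes (p , _)) (yes q) = ⊥-elim (¬w↭
    (↭-trans (↭-reflexive (sym (take++drop≡id (suc j) w)))
    (↭-trans (++⁺ p q)
    (↭-reflexive (trans (sym ([1⋯+] (suc j) i)) (cong (λ k → [1⋯ suc k ]) (+-comm j i)))))))

!⋆f : ∀ n → (_! ⋆ (f ∘ suc)) n ≡ (suc n) !
!⋆f n = sym (begin
  (suc n) !
    ≡⟨ ∑-↭ ([1⋯]! (suc n)) (suc n) ([1⋯]! (suc n)) id (length-[1⋯] (suc n)) ⟨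
  ∑[ w ∈ V ] χ (toList w ↭? [1⋯ suc n ])
    ≡⟨ ∑-cong (λ w → first-component n (toList w) (length-toList w)) V ⟩
  ∑[ w ∈ V ] diag (λ i j → term (toList w) i j) n
    ≡⟨ ∑-diag (term ∘ toList) n V ⟩
  diag (λ i j → ∑[ w ∈ V ] term (toList w) i j) n
    ≡⟨ diag-cong n (λ i j i+j≡n → factor i j (trans (cong suc (sym i+j≡n)) (cong suc (+-comm i j)))) ⟩
  (_! ⋆ (f ∘ suc)) n ∎)
  where
  V = vectors [1⋯ suc n ] (suc n)

  term : List ℕ → ℕ → ℕ → ℕ
  term w i j = χ (isConnected? (suc j) (take (suc j) w)) * χ (drop (suc j) w ↭? block (suc j) i)

  factor : ∀ i j → suc n ≡ suc j + i → ∑[ w ∈ V ] term (toList w) i j ≡ i ! * f (suc j)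
  factor i j eq = begin
    ∑[ w ∈ V ] term (toList w) i j
      ≡⟨ cong (λ m → ∑[ w ∈ vectors [1⋯ m ] m ] term (toList w) i j) eq ⟩
    ∑[ w ∈ vectors X (suc j + i) ] term (toList w) i j
      ≡⟨ ∑-vectors-take-drop X (suc j) i (λ u → χ (isConnected? (suc j) u)) (λ v → χ (v ↭? block (suc j) i)) ⟩
    ∑[ u ∈ vectors X (suc j) ] χ (isConnected? (suc j) (toList u)) * ∑[ v ∈ vectors X i ] χ (toList v ↭? block (suc j) i)
      ≡⟨ cong₂ _*_ (∑-connected (suc j) i) (∑-block (suc j) i) ⟩
    f (suc j) * i !
      ≡⟨ *-comm (f (suc j)) (i !) ⟩
    i ! * f (suc j) ∎
    where X = [1⋯ suc j + i ]

corollary1p2 : (n : ℕ) → sum (map (λ T → 2 ^ urc T) (𝒫𝒯 n)) ≡ f (suc n)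
corollary1p2 n = trans (∑-𝒫𝒯 n)
  (⋆-cancelˡ {a = _!} refl (λ m → trans (!⋆∑ψ m) (sym (!⋆f m))) n)
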